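{- $d_{K_5}(n)\ge \frac{1}{n^{o(1)}}$; that is, there is a function $\varepsilon(n)\to 0$ as $n\to\infty$ such that $d_{K_5}(n)\ge n^{ -\varepsilon(n)}$ for all $n$.
   Context: For a graph $H$, a collection $\mathcal{F}$ of graphs on vertex set $[n]$ is an $H$-code if it contains no two members whose symmetric difference (as edge sets on $[n]$) is isomorphic to $H$. $D_H(n)$ is the maximum cardinality of an $H$-code on $[n]$, and $d_H(n)=D_H(n)/2^{\binom{n}{2}}$. -}

module Defs where

open import Data.Nat using (ℕ; _<_; _≤_; _^_; _*_)
open import Data.Nat.Combinatorics using (_C_)
open import Data.Bool using (Bool; true; _xor_)
open import Data.Fin using (Fin; toℕ)
open import Data.List using (List; length)
open import Data.List.Relation.Unary.AllPairs using (AllPairs)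
open import Data.Product using (Σ; ∃; ∃-syntax; _×_)
open import Function.Definitions using (Injective)
open import Function.Bundles using (_⇔_)
open import Relation.Binary.PropositionalEquality using (_≡_)
open import Relation.Nullary using (¬_)

-- A graph on vertex set [n] = Fin n, given by its adjacency function.
-- Only the entries G i j with toℕ i < toℕ j are meaningful: the edge {i,j}
-- (i < j) is present iff G i j ≡ true.  Entries with i ≥ j are ignored.
Graph : ℕ → Set
Graph n = Fin n → Fin n → Bool

DifferentGraphs : ∀ {n} → Graph n → Graph n → Set
DifferentGraphs {n} G G' = ∃[ i ] ∃[ j ] (toℕ i < toℕ j × ¬ (G i j ≡ G' i j))

symDiff : ∀ {n} → Graph n → Graph n → Graph n
symDiff G G' i j = G i j xor G' i j

-- The graph S (up to isolated vertices) is isomorphic to K₅: there are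
-- 5 distinct vertices such that the edges of S are exactly the pairs among them.
IsK5 : ∀ {n} → Graph n → Set
IsK5 {n} S =
  Σ (Fin 5 → Fin n) λ f → Injective _≡_ _≡_ f ×
    (∀ (i j : Fin n) → toℕ i < toℕ j →
       (S i j ≡ true) ⇔ ((∃[ a ] f a ≡ i) × (∃[ b ] f b ≡ j)))

-- A K₅-code on [n]: a list of pairwise distinct graphs no two of which
-- have symmetric difference isomorphic to K₅.  Its cardinality is its length.
K5Code : (n : ℕ) → List (Graph n) → Set
K5Code n F = AllPairs (λ G G' → DifferentGraphs G G' × ¬ IsK5 (symDiff G G')) F

{-# OPTIONS --safe #-}

-- Colour the edges of K_n with n^o(1) colours so that every K₅ has a colour class of odd size.
-- Then record, for a graph G, the power sums of orders 0,…,9 of the set of colours that G uses an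
-- odd number of times. These take n^o(1) values, and they differ for two graphs whose symmetric
-- difference is a K₅: the two colour sets then differ in between 1 and 10 elements, and a
-- Vandermonde argument applies. So the largest fibre of this invariant is a dense code.
--
-- For the colouring, cut the binary expansion of a vertex into t blocks of length s. The colour of
-- xy consists of the first position where x and y differ, the common bits before it within its
-- block, and, for every block, the first difference inside the block together with a sign. In a
-- K₅ with all colour classes even, the first splitting bit divides the vertices as 4 + 1 or 3 + 2.
-- Edges across differ in colour from edges inside, so both kinds have even classes by themselves.
-- Splitting the larger part again yields disjoint edges ab and de of the same colour on opposite
-- sides of a split (with possibly one further vertex on the side of ab). The signed differences in
-- the block where a and b first differ then single out an odd number of edges across that split.

module Submission where

open import Defs
open import Algebra.Bundles using (CommutativeMonoid; CommutativeRing)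
import Algebra.Properties.CommutativeMonoid.Sum as MonoidSum
import Algebra.Properties.Semiring.Sum as SemiringSum
open import Data.Bool using (Bool; true; false; not; _∧_; _xor_; if_then_else_)
import Data.Bool.Properties as Bool
open import Data.Bool.Solver using (module xor-∧-Solver)
open import Data.Empty using (⊥)
open import Data.Fin as Fin using (Fin; toℕ; fromℕ<; combine; remQuot; finToFun; funToFin)
import Data.Fin.Properties as Fin
open import Data.Integer as ℤ using (ℤ; +_; 0ℤ)
import Data.Integer.Properties as ℤ
import Data.Integer.Solver as ℤ
open import Data.List
  using (List; []; _∷_; _++_; length; map; filter; allFin; tabulate; cartesianProductWith)
import Data.List.Extrema
open import Data.List.Membership.Propositional using (_∈_)
import Data.List.Membership.Propositional.Properties as ∈
open import Data.List.Membership.Propositional.Properties.WithK using (unique∧set⇒bag)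
open import Data.List.Properties using (length-++; length-map; length-tabulate)
open import Data.List.Relation.Binary.BagAndSetEquality using (∼bag⇒↭)
open import Data.List.Relation.Binary.Permutation.Propositional.Properties using (↭-length)
open import Data.List.Relation.Ternary.Interleaving using (swap)
open import Data.List.Relation.Ternary.Interleaving.Propositional
  using (Interleaving; []; consˡ; consʳ)
open import Data.List.Relation.Ternary.Interleaving.Properties using (interleave-length)
open import Data.List.Relation.Unary.All as All using (All; []; _∷_)
import Data.List.Relation.Unary.All.Properties as All
open import Data.List.Relation.Unary.AllPairs as AllPairs using (AllPairs; []; _∷_)
import Data.List.Relation.Unary.AllPairs.Properties as AllPairs
open import Data.List.Relation.Unary.Any using (here; there)
open import Data.List.Relation.Unary.Unique.Propositional using (Unique)
import Data.List.Relation.Unary.Unique.Propositional.Properties as Unique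
open import Data.Nat hiding (parity)
open import Data.Nat.Combinatorics using (_C_; nC1≡n; nCk+nC[k+1]≡[n+1]C[k+1])
open import Data.Nat.DivMod
open import Data.Nat.Properties
import Data.Nat.Solver as ℕ
open import Data.Product using (Σ; ∃₂; ∃-syntax; _×_; _,_; proj₁; proj₂)
open import Data.Sum using (inj₁; inj₂)
open import Data.Vec.Functional as Vector using (Vector)
open import Function using (_∘_; case_of_)
open import Function.Bundles using (_⇔_; mk⇔; module Equivalence)
open import Relation.Binary.Definitions using (tri<; tri≈; tri>)
open import Relation.Binary.PropositionalEquality
import Relation.Binary.Reasoning.Setoid as SetoidReasoning
open import Relation.Nullary using (¬_; Dec; yes; no; contradiction)
open import Relation.Nullary.Decidable using (⌊_⌋; does)
open import Relation.Unary using (Decidable)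

private variable
  A : Set

-- Parity sums over pairs

row : (A → A → Bool) → A → List A → Bool
row h x []       = false
row h x (y ∷ ys) = h x y xor row h x ys

pairs : (A → A → Bool) → List A → Bool
pairs h []       = false
pairs h (x ∷ xs) = row h x xs xor pairs h xs

cross : (A → A → Bool) → List A → List A → Bool
cross h []       ys = false
cross h (x ∷ xs) ys = row h x ys xor cross h xs ys

row-cong : ∀ {h h′ : A → A → Bool} {x ys} → All (λ y → h x y ≡ h′ x y) ys →
           row h x ys ≡ row h′ x ys
row-cong []       = refl
row-cong (e ∷ es) = cong₂ _xor_ e (row-cong es)

pairs-cong : ∀ {h h′ : A → A → Bool} {xs} → AllPairs (λ x y → h x y ≡ h′ x y) xs →
             pairs h xs ≡ pairs h′ xs
pairs-cong []       = refl
pairs-cong (e ∷ es) = cong₂ _xor_ (row-cong e) (pairs-cong es)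

cross-cong : ∀ {h h′ : A → A → Bool} {xs ys} → All (λ x → All (λ y → h x y ≡ h′ x y) ys) xs →
             cross h xs ys ≡ cross h′ xs ys
cross-cong []       = refl
cross-cong (e ∷ es) = cong₂ _xor_ (row-cong e) (cross-cong es)

row-false : ∀ (x : A) ys → row (λ _ _ → false) x ys ≡ false
row-false x []       = refl
row-false x (y ∷ ys) = row-false x ys

pairs-false : ∀ (xs : List A) → pairs (λ _ _ → false) xs ≡ false
pairs-false []       = refl
pairs-false (x ∷ xs) = cong₂ _xor_ (row-false x xs) (pairs-false xs)

cross-false : ∀ (xs ys : List A) → cross (λ _ _ → false) xs ys ≡ false
cross-false []       ys = refl
cross-false (x ∷ xs) ys = cong₂ _xor_ (row-false x ys) (cross-false xs ys)

xor-interchange : ∀ a b c d → (a xor b) xor (c xor d) ≡ (a xor c) xor (b xor d)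
xor-interchange = solve 4 (λ a b c d → (a :+ b) :+ (c :+ d) := (a :+ c) :+ (b :+ d)) refl
  where open xor-∧-Solver

xor-cancelˡ : ∀ {a b} → a xor b ≡ false → a ≡ b
xor-cancelˡ {true}  {true}  _ = refl
xor-cancelˡ {false} {false} _ = refl

xor-≢ : ∀ {a b} → a ≢ b → a xor b ≡ true
xor-≢ {true}  {true}  ne = contradiction refl ne
xor-≢ {true}  {false} ne = refl
xor-≢ {false} {true}  ne = refl
xor-≢ {false} {false} ne = contradiction refl ne

row-xor : ∀ (h h′ : A → A → Bool) x ys →
          row (λ u v → h u v xor h′ u v) x ys ≡ row h x ys xor row h′ x ys
row-xor h h′ x []       = refl
row-xor h h′ x (y ∷ ys) = trans (cong ((h x y xor h′ x y) xor_) (row-xor h h′ x ys))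
  (xor-interchange (h x y) (h′ x y) (row h x ys) (row h′ x ys))

pairs-xor : ∀ (h h′ : A → A → Bool) xs →
            pairs (λ u v → h u v xor h′ u v) xs ≡ pairs h xs xor pairs h′ xs
pairs-xor h h′ []       = refl
pairs-xor h h′ (x ∷ xs) = trans (cong₂ _xor_ (row-xor h h′ x xs) (pairs-xor h h′ xs))
  (xor-interchange (row h x xs) (row h′ x xs) (pairs h xs) (pairs h′ xs))

row-interleave : ∀ (h : A → A → Bool) x {as bs l} → Interleaving as bs l →
                 row h x l ≡ row h x as xor row h x bs
row-interleave h x [] = refl
row-interleave h x {a ∷ as} {bs} (consˡ sp) =
  trans (cong (h x a xor_) (row-interleave h x sp))
    (sym (Bool.xor-assoc (h x a) (row h x as) (row h x bs)))
row-interleave h x {as} {b ∷ bs} (consʳ sp) =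
  trans (cong (h x b xor_) (row-interleave h x sp))
    (solve 3 (λ y p q → y :+ (p :+ q) := p :+ (y :+ q)) refl (h x b) (row h x as) (row h x bs))
  where open xor-∧-Solver

cross-interleave : ∀ (h : A → A → Bool) {as bs l} ys → Interleaving as bs l →
                   cross h l ys ≡ cross h as ys xor cross h bs ys
cross-interleave h ys [] = refl
cross-interleave h {a ∷ as} {bs} ys (consˡ sp) =
  trans (cong (row h a ys xor_) (cross-interleave h ys sp))
    (sym (Bool.xor-assoc (row h a ys) (cross h as ys) (cross h bs ys)))
cross-interleave h {as} {b ∷ bs} ys (consʳ sp) =
  trans (cong (row h b ys xor_) (cross-interleave h ys sp))
    (solve 3 (λ y p q → y :+ (p :+ q) := p :+ (y :+ q)) refl (row h b ys) (cross h as ys) (cross h bs ys))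
  where open xor-∧-Solver

cross-∷ʳ : ∀ (h : A → A → Bool) → (∀ u v → h u v ≡ h v u) → ∀ xs y ys →
           cross h xs (y ∷ ys) ≡ row h y xs xor cross h xs ys
cross-∷ʳ h h-sym []       y ys = refl
cross-∷ʳ h h-sym (x ∷ xs) y ys = begin
  (h x y xor row h x ys) xor cross h xs (y ∷ ys)
    ≡⟨ cong₂ (λ b c → (b xor row h x ys) xor c) (h-sym x y) (cross-∷ʳ h h-sym xs y ys) ⟩
  (h y x xor row h x ys) xor (row h y xs xor cross h xs ys)
    ≡⟨ xor-interchange (h y x) (row h x ys) (row h y xs) (cross h xs ys) ⟩
  (h y x xor row h y xs) xor (row h x ys xor cross h xs ys) ∎
  where open ≡-Reasoning

-- A pair of `l` lies inside `as`, inside `bs`, or across. Symmetry of `h` enters for the pairs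
-- across: either endpoint may come first in `l`, while `cross` always takes the one in `as` first.
pairs-interleave : ∀ (h : A → A → Bool) → (∀ u v → h u v ≡ h v u) →
                   ∀ {as bs l} → Interleaving as bs l →
                   pairs h l ≡ (pairs h as xor pairs h bs) xor cross h as bs
pairs-interleave h h-sym [] = refl
pairs-interleave h h-sym {a ∷ as} {bs} {l = _ ∷ l} (consˡ sp) = begin
  row h a l xor pairs h l
    ≡⟨ cong₂ _xor_ (row-interleave h a sp) (pairs-interleave h h-sym sp) ⟩
  (row h a as xor row h a bs) xor ((pairs h as xor pairs h bs) xor cross h as bs)
    ≡⟨ solve 5 (λ r r′ p q c → (r :+ r′) :+ ((p :+ q) :+ c) := ((r :+ p) :+ q) :+ (r′ :+ c)) refl
         (row h a as) (row h a bs) (pairs h as) (pairs h bs) (cross h as bs) ⟩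
  ((row h a as xor pairs h as) xor pairs h bs) xor (row h a bs xor cross h as bs) ∎
  where open ≡-Reasoning
        open xor-∧-Solver
pairs-interleave h h-sym {as} {b ∷ bs} {l = _ ∷ l} (consʳ sp) = begin
  row h b l xor pairs h l
    ≡⟨ cong₂ _xor_ (row-interleave h b sp) (pairs-interleave h h-sym sp) ⟩
  (row h b as xor row h b bs) xor ((pairs h as xor pairs h bs) xor cross h as bs)
    ≡⟨ solve 5 (λ r r′ p q c → (r :+ r′) :+ ((p :+ q) :+ c) := (p :+ (r′ :+ q)) :+ (r :+ c)) refl
         (row h b as) (row h b bs) (pairs h as) (pairs h bs) (cross h as bs) ⟩
  (pairs h as xor (row h b bs xor pairs h bs)) xor (row h b as xor cross h as bs)
    ≡⟨ cong ((pairs h as xor (row h b bs xor pairs h bs)) xor_) (cross-∷ʳ h h-sym as b bs) ⟨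
  (pairs h as xor (row h b bs xor pairs h bs)) xor cross h as (b ∷ bs) ∎
  where open ≡-Reasoning
        open xor-∧-Solver

interleave-All : ∀ {P : A → Set} {as bs l} → Interleaving as bs l → All P as → All P bs → All P l
interleave-All []         []       []       = []
interleave-All (consˡ sp) (p ∷ ps) qs       = p ∷ interleave-All sp ps qs
interleave-All (consʳ sp) ps       (q ∷ qs) = q ∷ interleave-All sp ps qs

All-interleaveˡ : ∀ {P : A → Set} {as bs l} → Interleaving as bs l → All P l → All P as
All-interleaveˡ []         []       = []
All-interleaveˡ (consˡ sp) (p ∷ ps) = p ∷ All-interleaveˡ sp ps
All-interleaveˡ (consʳ sp) (p ∷ ps) = All-interleaveˡ sp ps

AllPairs-interleaveˡ : ∀ {R : A → A → Set} {as bs l} → Interleaving as bs l → AllPairs R l → AllPairs R as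
AllPairs-interleaveˡ []         []       = []
AllPairs-interleaveˡ (consˡ sp) (p ∷ ps) = All-interleaveˡ sp p ∷ AllPairs-interleaveˡ sp ps
AllPairs-interleaveˡ (consʳ sp) (p ∷ ps) = AllPairs-interleaveˡ sp ps

bisect : (f : A → Bool) (l : List A) →
         ∃₂ λ as bs → Interleaving as bs l × All (λ x → f x ≡ true) as × All (λ x → f x ≡ false) bs
bisect f [] = [] , [] , [] , [] , []
bisect f (x ∷ l) with f x in eq | bisect f l
... | true  | as , bs , sp , ps , qs = x ∷ as , bs , consˡ sp , eq ∷ ps , qs
... | false | as , bs , sp , ps , qs = as , x ∷ bs , consʳ sp , ps , eq ∷ qs

-- The colouring

-- Infinite sequences make every index valid; vertices are told apart by the positions below `L`
-- only.
Bits : Set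
Bits = ℕ → Bool

-- A value below `L` is the first position of difference; the value `L` itself means that none was
-- found.
lcp : ℕ → Bits → Bits → ℕ
lcp zero    x y = 0
lcp (suc L) x y = if does (x 0 Bool.≟ y 0) then suc (lcp L (x ∘ suc) (y ∘ suc)) else 0

lcp≤ : ∀ L x y → lcp L x y ≤ L
lcp≤ zero    x y = z≤n
lcp≤ (suc L) x y with x 0 Bool.≟ y 0
... | yes _ = s≤s (lcp≤ L (x ∘ suc) (y ∘ suc))
... | no  _ = z≤n

lcp-agree : ∀ L {x y i} → i < lcp L x y → x i ≡ y i
lcp-agree (suc L) {x} {y} {i} i<l with x 0 Bool.≟ y 0
lcp-agree (suc L) {i = zero}  i<l       | yes e = e
lcp-agree (suc L) {i = suc i} (s≤s i<l) | yes e = lcp-agree L i<l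

lcp-differ : ∀ L {x y} → lcp L x y < L → x (lcp L x y) ≢ y (lcp L x y)
lcp-differ (suc L) {x} {y} l<L with x 0 Bool.≟ y 0
... | yes e = lcp-differ L (s≤s⁻¹ l<L)
... | no ne = ne

lcp-unique : ∀ L {x y d} → (∀ {i} → i < d → x i ≡ y i) → x d ≢ y d → d < L → lcp L x y ≡ d
lcp-unique L {x} {y} {d} agree differ d<L with <-cmp (lcp L x y) d
... | tri< l<d _ _ = contradiction (agree l<d) (lcp-differ L (<-trans l<d d<L))
... | tri≈ _ e _   = e
... | tri> _ _ l>d = contradiction (lcp-agree L l>d) differ

lcp-sym : ∀ L x y → lcp L x y ≡ lcp L y x
lcp-sym zero    x y = refl
lcp-sym (suc L) x y with x 0 Bool.≟ y 0 | y 0 Bool.≟ x 0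
... | yes _ | yes _ = cong suc (lcp-sym L (x ∘ suc) (y ∘ suc))
... | yes e | no ne = contradiction (sym e) ne
... | no ne | yes e = contradiction (sym e) ne
... | no _  | no _  = refl

block : ℕ → ℕ → Bits → Bits
block s j x p = x (p + j * s)

-- At positions p and d where x and y both differ, x p xor x d is symmetric in x and y; elsewhere
-- the value is the junk false.
sign : Bits → Bits → ℕ → ℕ → Bool
sign x y p d = (x p xor x d) ∧ ((x p xor y p) ∧ (x d xor y d))

sign-sym : ∀ x y p d → sign x y p d ≡ sign y x p d
sign-sym x y p d = lemma (x p) (x d) (y p) (y d)
  where
  lemma : ∀ a b c e → (a xor b) ∧ ((a xor c) ∧ (b xor e)) ≡ (c xor e) ∧ ((c xor a) ∧ (e xor b))
  lemma true  b     true  e     = trans (Bool.∧-zeroʳ (not b)) (sym (Bool.∧-zeroʳ (not e)))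
  lemma false b     false e     = trans (Bool.∧-zeroʳ b) (sym (Bool.∧-zeroʳ e))
  lemma true  true  false true  = refl
  lemma true  true  false false = refl
  lemma true  false false true  = refl
  lemma true  false false false = refl
  lemma false true  true  true  = refl
  lemma false true  true  false = refl
  lemma false false true  true  = refl
  lemma false false true  false = refl

bit : Bool → Fin 2
bit b = if b then Fin.suc Fin.zero else Fin.zero

unbit : Fin 2 → Bool
unbit Fin.zero    = false
unbit (Fin.suc _) = true

unbit-bit : ∀ b → unbit (bit b) ≡ b
unbit-bit true  = refl
unbit-bit false = refl

-- The factors count the first difference, the bits before it in its block, and, for each of the `t`
-- blocks, an inner first difference (`s` meaning none) with a sign.
colourCount : ℕ → ℕ → ℕ
colourCount s t = suc (t * s) * (2 ^ s * (suc s * 2) ^ t)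

module Colouring (s : ℕ) .{{_ : NonZero s}} (t : ℕ) where

  L : ℕ
  L = t * s

  δ : Bits → Bits → ℕ
  δ = lcp L

  μ : ℕ → Bits → Bits → ℕ
  μ j x y = lcp s (block s j x) (block s j y)

  -- Padding with `false` from the first difference on keeps the length fixed at `s` and the value
  -- symmetric, since `x` and `y` agree before that position.
  prefix : Bits → Bits → Fin s → Fin 2
  prefix x y p = bit (⌊ toℕ p <? δ x y % s ⌋ ∧ block s (δ x y / s) x (toℕ p))

  -- The sign compares the bit at the first difference inside block `j` with the bit at the overall
  -- first difference. Once the latter bit is known for one endpoint, the sign reveals that
  -- endpoint's bit in block `j`, although the colour itself does not order the endpoints.
  marks : Bits → Bits → Fin t → Fin (suc s * 2)
  marks x y j = combine (fromℕ< (s≤s (lcp≤ s (block s (toℕ j) x) (block s (toℕ j) y))))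
                        (bit (sign x y (μ (toℕ j) x y + toℕ j * s) (δ x y)))

  Colour : Set
  Colour = Fin (colourCount s t)

  colour : Bits → Bits → Colour
  colour x y = combine (fromℕ< (s≤s (lcp≤ L x y)))
                       (combine (funToFin (prefix x y)) (funToFin (marks x y)))

  depth : Colour → ℕ
  depth κ = toℕ (proj₁ (remQuot {suc L} (2 ^ s * (suc s * 2) ^ t) κ))

  marking : Colour → Fin t → Fin (suc s) × Fin 2
  marking κ j = remQuot 2 (finToFun (proj₂ (remQuot {2 ^ s} ((suc s * 2) ^ t)
    (proj₂ (remQuot {suc L} (2 ^ s * (suc s * 2) ^ t) κ)))) j)

  mark : Colour → Fin t → ℕ
  mark κ j = toℕ (proj₁ (marking κ j))

  side : Colour → Fin t → Bool
  side κ j = unbit (proj₂ (marking κ j))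

  depth-colour : ∀ x y → depth (colour x y) ≡ δ x y
  depth-colour x y = trans
    (cong (toℕ ∘ proj₁)
      (Fin.remQuot-combine {k = 2 ^ s * (suc s * 2) ^ t} (fromℕ< (s≤s (lcp≤ L x y))) _))
    (Fin.toℕ-fromℕ< _)

  marking-colour : ∀ x y j → marking (colour x y) j ≡ remQuot 2 (marks x y j)
  marking-colour x y j = cong (remQuot 2) (begin
    finToFun (proj₂ (remQuot {2 ^ s} _ (proj₂ (remQuot {suc L} _ (colour x y))))) j
      ≡⟨ cong (λ r → finToFun (proj₂ (remQuot {2 ^ s} ((suc s * 2) ^ t) (proj₂ r))) j)
           (Fin.remQuot-combine (fromℕ< (s≤s (lcp≤ L x y))) _) ⟩
    finToFun (proj₂ (remQuot {2 ^ s} _ (combine (funToFin (prefix x y)) (funToFin (marks x y))))) j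
      ≡⟨ cong (λ r → finToFun (proj₂ r) j)
           (Fin.remQuot-combine (funToFin (prefix x y)) (funToFin (marks x y))) ⟩
    finToFun (funToFin (marks x y)) j
      ≡⟨ Fin.finToFun-funToFin (marks x y) j ⟩
    marks x y j ∎)
    where open ≡-Reasoning

  mark-colour : ∀ x y j → mark (colour x y) j ≡ μ (toℕ j) x y
  mark-colour x y j = trans
    (cong (toℕ ∘ proj₁) (trans (marking-colour x y j) (Fin.remQuot-combine _ _)))
    (Fin.toℕ-fromℕ< _)

  side-colour : ∀ x y j → side (colour x y) j ≡ sign x y (μ (toℕ j) x y + toℕ j * s) (δ x y)
  side-colour x y j = trans
    (cong (unbit ∘ proj₂) (trans (marking-colour x y j)
      (Fin.remQuot-combine (fromℕ< (s≤s (lcp≤ s (block s (toℕ j) x) (block s (toℕ j) y)))) _)))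
    (unbit-bit _)

  δ≡ : ∀ x y → δ x y ≡ δ x y % s + δ x y / s * s
  δ≡ x y = m≡m%n+[m/n]*n (δ x y) s

  prefix-sym : ∀ x y p → prefix x y p ≡ prefix y x p
  prefix-sym x y p rewrite lcp-sym L y x with toℕ p <? δ x y % s
  ... | no _  = refl
  ... | yes l = cong bit (lcp-agree L (≤-trans (+-monoˡ-< (δ x y / s * s) l) (≤-reflexive (sym (δ≡ x y)))))

  marks-sym : ∀ x y j → marks x y j ≡ marks y x j
  marks-sym x y j = cong₂ combine
    (Fin.fromℕ<-cong _ _ (lcp-sym s (block s (toℕ j) x) (block s (toℕ j) y)) _ _)
    (cong bit (begin
      sign x y (μ (toℕ j) x y + toℕ j * s) (δ x y)
        ≡⟨ cong₂ (λ m d → sign x y (m + toℕ j * s) d) (lcp-sym s _ _) (lcp-sym L x y) ⟩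
      sign x y (μ (toℕ j) y x + toℕ j * s) (δ y x)
        ≡⟨ sign-sym x y _ _ ⟩
      sign y x (μ (toℕ j) y x + toℕ j * s) (δ y x) ∎))
    where open ≡-Reasoning

  funToFin-cong : ∀ {m n} {f g : Fin m → Fin n} → f ≗ g → funToFin f ≡ funToFin g
  funToFin-cong {zero}  e = refl
  funToFin-cong {suc m} e = cong₂ combine (e Fin.zero) (funToFin-cong (e ∘ Fin.suc))

  colour-sym : ∀ x y → colour x y ≡ colour y x
  colour-sym x y = cong₂ combine (Fin.fromℕ<-cong _ _ (lcp-sym L x y) _ _)
    (cong₂ combine (funToFin-cong (prefix-sym x y)) (funToFin-cong (marks-sym x y)))

  prefix-colour : ∀ {a b d e} → colour a b ≡ colour d e → prefix a b ≗ prefix d e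
  prefix-colour {a} {b} {d} {e} eq p = begin
    prefix a b p                       ≡⟨ Fin.finToFun-funToFin (prefix a b) p ⟨
    finToFun (funToFin (prefix a b)) p ≡⟨ cong (λ r → finToFun r p)
      (Fin.combine-injectiveˡ (funToFin (prefix a b)) (funToFin (marks a b)) _ _
        (Fin.combine-injectiveʳ (fromℕ< (s≤s (lcp≤ L a b))) _ (fromℕ< (s≤s (lcp≤ L d e))) _ eq)) ⟩
    finToFun (funToFin (prefix d e)) p ≡⟨ Fin.finToFun-funToFin (prefix d e) p ⟩
    prefix d e p ∎
    where open ≡-Reasoning

  -- Even lists of vertices and their splits

  Distinct : List Bits → Set
  Distinct = AllPairs (λ x y → δ x y < L)

  -- Ranging over all sets `P` of colours, rather than single classes, allows `P` to be restricted
  -- to colours of chosen depths.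
  Even : List Bits → Set
  Even l = ∀ (P : Colour → Bool) → pairs (λ x y → P (colour x y)) l ≡ false

  -- It follows that `d` is the first position at which the list is not constant. The two bits are
  -- left open so that the sides can be exchanged.
  record Split (l as bs : List Bits) (d : ℕ) : Set where
    field
      shuffle  : Interleaving as bs l
      d<L      : d < L
      {β γ}    : Bool
      bitˡ     : All (λ x → x d ≡ β) as
      bitʳ     : All (λ y → y d ≡ γ) bs
      across   : All (λ x → All (λ y → δ x y ≡ d) bs) as
      nonemptyˡ : as ≢ []
      nonemptyʳ : bs ≢ []

  Split-swap : ∀ {l as bs d} → Split l as bs d → Split l bs as d
  Split-swap sp = record
    { shuffle = swap shuffle ; d<L = d<L ; bitˡ = bitʳ ; bitʳ = bitˡ
    ; across = All.map (All.map (λ {x} e → trans (lcp-sym L _ _) e)) (All.All-swap across)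
    ; nonemptyˡ = nonemptyʳ ; nonemptyʳ = nonemptyˡ }
    where open Split sp

  -- Let `z` be a member that departs from `x` earliest, at `d`. All members agree with `x` before
  -- `d`, so any two with different bits at `d` first differ there. Both sides are inhabited because
  -- `x` and `z` differ at `d`.
  split : ∀ x y l → Distinct (x ∷ y ∷ l) → ∃₂ λ as bs → ∃[ d ] Split (x ∷ y ∷ l) as bs d
  split x y l ((xy<L ∷ xl<L) ∷ _) = as , bs , d , record
    { shuffle = shuffle ; d<L = d<L ; bitˡ = trues ; bitʳ = falses
    ; across = All.zipWith
        (λ (ag , tr) → All.zipWith (λ (ag′ , fa) → meet ag ag′ tr fa)
                         (All-interleaveˡ (swap shuffle) agreement , falses))
        (All-interleaveˡ shuffle agreement , trues)
    ; nonemptyˡ = λ e → constant (interleave-All shuffle (subst (All _) (sym e) []) falses)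
    ; nonemptyʳ = λ e → constant (interleave-All shuffle trues (subst (All _) (sym e) []))
    }
    where
    open Data.List.Extrema ≤-totalOrder
    z : Bits
    z = argmin (δ x) y l
    z∈ : z ∈ y ∷ l
    z∈ with argmin-sel (δ x) y l
    ... | inj₁ e  = here e
    ... | inj₂ z∈l = there z∈l
    d : ℕ
    d = δ x z
    d<L : d < L
    d<L = All.lookup (xy<L ∷ xl<L) z∈
    as bs : List Bits
    as = proj₁ (bisect (λ u → u d) (x ∷ y ∷ l))
    bs = proj₁ (proj₂ (bisect (λ u → u d) (x ∷ y ∷ l)))
    shuffle : Interleaving as bs (x ∷ y ∷ l)
    shuffle = proj₁ (proj₂ (proj₂ (bisect (λ u → u d) (x ∷ y ∷ l))))
    trues : All (λ u → u d ≡ true) as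
    trues = proj₁ (proj₂ (proj₂ (proj₂ (bisect (λ u → u d) (x ∷ y ∷ l)))))
    falses : All (λ u → u d ≡ false) bs
    falses = proj₂ (proj₂ (proj₂ (proj₂ (bisect (λ u → u d) (x ∷ y ∷ l)))))
    agreement : All (λ u → ∀ i → i < d → x i ≡ u i) (x ∷ y ∷ l)
    agreement = (λ _ _ → refl)
              ∷ All.map (λ d≤ _ i<d → lcp-agree L (<-≤-trans i<d d≤))
                  (f[argmin]≤f[⊤] {f = δ x} y l ∷ f[argmin]≤f[xs] {f = δ x} y l)
    meet : ∀ {u v} → (∀ i → i < d → x i ≡ u i) → (∀ i → i < d → x i ≡ v i) →
           u d ≡ true → v d ≡ false → δ u v ≡ d
    meet ag ag′ tr fa = lcp-unique L (λ i<d → trans (sym (ag _ i<d)) (ag′ _ i<d))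
                          (λ e → case trans (sym tr) (trans e fa) of λ ()) d<L
    constant : ∀ {b} → All (λ u → u d ≡ b) (x ∷ y ∷ l) → ⊥
    constant es@(e ∷ _) = lcp-differ L d<L (trans e (sym (All.lookup es (there z∈))))

  -- For a split at `d`, edges across have depth `d`, and edges inside a side do not, as their ends
  -- share the bit at `d`. So `only` isolates the former and `except` the latter.
  only except : ℕ → (Colour → Bool) → Colour → Bool
  only   d P κ = P κ ∧ ⌊ depth κ ≟ d ⌋
  except d P κ = P κ ∧ not ⌊ depth κ ≟ d ⌋

  only-≡ : ∀ P {x y d} → δ x y ≡ d → only d P (colour x y) ≡ P (colour x y)
  only-≡ P {x} {y} {d} e with depth (colour x y) ≟ d
  ... | yes _ = Bool.∧-identityʳ _
  ... | no ne = contradiction (trans (depth-colour x y) e) ne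

  only-≢ : ∀ P {x y d} → δ x y ≢ d → only d P (colour x y) ≡ false
  only-≢ P {x} {y} {d} ne with depth (colour x y) ≟ d
  ... | yes e = contradiction (trans (sym (depth-colour x y)) e) ne
  ... | no _  = Bool.∧-zeroʳ _

  except-≡ : ∀ P {x y d} → δ x y ≡ d → except d P (colour x y) ≡ false
  except-≡ P {x} {y} {d} e with depth (colour x y) ≟ d
  ... | yes _ = Bool.∧-zeroʳ _
  ... | no ne = contradiction (trans (depth-colour x y) e) ne

  except-≢ : ∀ P {x y d} → δ x y ≢ d → except d P (colour x y) ≡ P (colour x y)
  except-≢ P {x} {y} {d} ne with depth (colour x y) ≟ d
  ... | yes e = contradiction (trans (sym (depth-colour x y)) e) ne
  ... | no _  = Bool.∧-identityʳ _

  same-bit : ∀ {β d l} → d < L → All (λ x → x d ≡ β) l → AllPairs (λ x y → δ x y ≢ d) l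
  same-bit d<L []       = []
  same-bit d<L (e ∷ es) = All.map (λ { e′ refl → lcp-differ L d<L (trans e (sym e′)) }) es ∷ same-bit d<L es

  P-sym : ∀ (P : Colour → Bool) x y → P (colour x y) ≡ P (colour y x)
  P-sym P x y = cong P (colour-sym x y)

  module _ {l as bs d} (even : Even l) (sp : Split l as bs d) where
    open Split sp

    -- Evenness is applied to `except d P`: the edges across drop out and those inside the sides
    -- keep their value.
    within-even : ∀ (P : Colour → Bool) →
                  pairs (λ x y → P (colour x y)) as ≡ pairs (λ x y → P (colour x y)) bs
    within-even P = xor-cancelˡ (begin
      pairs h as xor pairs h bs
        ≡⟨ Bool.xor-identityʳ _ ⟨
      (pairs h as xor pairs h bs) xor false
        ≡⟨ cong₂ _xor_ (cong₂ _xor_ (pairs-cong (AllPairs.map (except-≢ P) (same-bit d<L bitˡ)))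
                                    (pairs-cong (AllPairs.map (except-≢ P) (same-bit d<L bitʳ))))
             (trans (cross-cong (All.map (All.map (except-≡ P)) across)) (cross-false as bs)) ⟨
      (pairs h′ as xor pairs h′ bs) xor cross h′ as bs
        ≡⟨ pairs-interleave h′ (P-sym (except d P)) shuffle ⟨
      pairs h′ l
        ≡⟨ even (except d P) ⟩
      false ∎)
      where
      open ≡-Reasoning
      h h′ : Bits → Bits → Bool
      h  x y = P (colour x y)
      h′ x y = except d P (colour x y)

    -- Evenness is applied to `only d P`, which discards all edges inside the two sides.
    across-even : ∀ (P : Colour → Bool) → cross (λ x y → P (colour x y)) as bs ≡ false
    across-even P = begin
      cross h as bs
        ≡⟨ cross-cong (All.map (All.map (only-≡ P)) across) ⟨
      cross h′ as bs
        ≡⟨ cong₂ (λ a b → (a xor b) xor cross h′ as bs) (vanish bitˡ) (vanish bitʳ) ⟨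
      (pairs h′ as xor pairs h′ bs) xor cross h′ as bs
        ≡⟨ pairs-interleave h′ (P-sym (only d P)) shuffle ⟨
      pairs h′ l
        ≡⟨ even (only d P) ⟩
      false ∎
      where
      open ≡-Reasoning
      h h′ : Bits → Bits → Bool
      h  x y = P (colour x y)
      h′ x y = only d P (colour x y)
      vanish : ∀ {β xs} → All (λ x → x d ≡ β) xs → pairs h′ xs ≡ false
      vanish {xs = xs} es = trans (pairs-cong (AllPairs.map (only-≢ P) (same-bit d<L es))) (pairs-false xs)

  -- Two edges of one colour on opposite sides of a split

  module _ {a b d e : Bits} (ab~de : colour a b ≡ colour d e) (ab<L : δ a b < L) where

    private
      m p j : ℕ
      m = δ a b
      p = m % s
      j = m / s

      m≡ : m ≡ p + j * s
      m≡ = δ≡ a b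

      p<s : p < s
      p<s = m%n<n m s

      j′ : Fin t
      j′ = fromℕ< (m<n*o⇒m/o<n ab<L)

      j′≡ : toℕ j′ ≡ j
      j′≡ = Fin.toℕ-fromℕ< _

      de≡ : δ d e ≡ m
      de≡ = trans (sym (depth-colour d e)) (trans (cong depth (sym ab~de)) (depth-colour a b))

      Close : Bits → Bits → Set
      Close x y = ∀ {i} → i < p → block s j x i ≡ block s j y i

      agree⇒close : ∀ x y → (∀ {i} → i < m → x i ≡ y i) → Close x y
      agree⇒close x y ag i<p = ag (≤-trans (+-monoˡ-< (j * s) i<p) (≤-reflexive (sym m≡)))

      -- Before the first difference the padding in `prefix` is inactive, so decoding returns the
      -- actual bit.
      masked : ∀ x {q i} (i<s : i < s) → q ≡ m → i < p →
               unbit (bit (⌊ toℕ (fromℕ< i<s) <? q % s ⌋ ∧ block s (q / s) x (toℕ (fromℕ< i<s))))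
               ≡ block s j x i
      masked x {i = i} i<s refl i<p rewrite Fin.toℕ-fromℕ< i<s with i <? p
      ... | yes _  = unbit-bit _
      ... | no i≮p = contradiction i<p i≮p

      a~b : Close a b
      a~b = agree⇒close a b (lcp-agree L)

      -- Edges of the same colour share the recorded prefix, so `a` and `d` agree in block `j`
      -- before `p` even though they may differ in earlier blocks. This is what the prefix in the
      -- colour is for.
      a~d : Close a d
      a~d i<p = trans (sym (masked a i<s refl i<p))
        (trans (cong unbit (prefix-colour {a} {b} {d} {e} ab~de (fromℕ< i<s))) (masked d i<s de≡ i<p))
        where i<s = <-trans i<p p<s

      d~e : Close d e
      d~e = agree⇒close d e (λ i<m → lcp-agree L (subst (_ <_) (sym de≡) i<m))

      at-m : ∀ (x : Bits) → block s j x p ≡ x m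
      at-m x = cong x (sym m≡)

      μ≡p⇒differ : ∀ x y → μ j x y ≡ p → x m ≢ y m
      μ≡p⇒differ x y μ≡p eq = lcp-differ s (subst (_< s) (sym μ≡p) p<s)
        (subst (λ i → block s j x i ≡ block s j y i) (sym μ≡p) (trans (at-m x) (trans eq (sym (at-m y)))))

      -- Rewriting the test for a first difference at `p` as a sum of two bits turns the count over
      -- four edges into a finite Boolean check.
      μ-close : ∀ x y → Close x y → ⌊ μ j x y ≟ p ⌋ ≡ x m xor y m
      μ-close x y cl with μ j x y ≟ p | x m Bool.≟ y m
      ... | yes μ≡p | _      = sym (xor-≢ (μ≡p⇒differ x y μ≡p))
      ... | no  _   | yes eq = sym (trans (cong (_xor y m) eq) (Bool.xor-same (y m)))
      ... | no μ≢p  | no ne  = contradiction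
        (lcp-unique s cl (λ eq → ne (trans (sym (at-m x)) (trans eq (at-m y)))) p<s) μ≢p

    -- Detecting the pairs that first differ at position m within the block of m, with the bit of
    -- the left vertex at m prescribed, counts exactly one of the four edges between {a , b} and
    -- {d , e}. The prescribed bit is chosen so that the vertices of cs contribute nothing.
    rectangle : ∀ {cs β q} ρ → q < L →
                All (λ x → x q ≡ β) (a ∷ b ∷ cs) →
                All (λ x → All (λ y → δ x y ≡ q) (d ∷ e ∷ [])) (a ∷ b ∷ cs) →
                All (λ c → c m ≡ ρ) cs →
                ¬ (∀ (P : Colour → Bool) →
                   cross (λ x y → P (colour x y)) (a ∷ b ∷ cs) (d ∷ e ∷ []) ≡ false)
    rectangle {cs} {β} {q} ρ q<L (aβ ∷ bβ ∷ csβ) ((ad ∷ ae ∷ []) ∷ (bd ∷ be ∷ []) ∷ csq) csρ even =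
      case trans (sym (even P)) total of λ ()
      where
      -- When `x` and `y` differ at both `m` and `q`, the sign is `x m xor x q`, and `x q` is `β`.
      -- Adding `β xor ρ` therefore leaves `x m xor ρ`: the left vertex must have a bit other than
      -- `ρ` at `m`.
      P : Colour → Bool
      P κ = ⌊ mark κ j′ ≟ p ⌋ ∧ (side κ j′ xor (β xor ρ))

      h : Bits → Bits → Bool
      h x y = P (colour x y)

      side-at-m : ∀ {x y} → x q ≡ β → δ x y ≡ q → μ j x y ≡ p →
                  side (colour x y) j′ xor (β xor ρ) ≡ x m xor ρ
      side-at-m {x} {y} xβ refl μ≡p = begin
        side (colour x y) j′ xor (β xor ρ)
          ≡⟨ cong (_xor (β xor ρ)) (side-colour x y j′) ⟩
        sign x y (μ (toℕ j′) x y + toℕ j′ * s) q xor (β xor ρ)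
          ≡⟨ cong (λ i → sign x y (μ i x y + i * s) q xor (β xor ρ)) j′≡ ⟩
        sign x y (μ j x y + j * s) q xor (β xor ρ)
          ≡⟨ cong (λ i → sign x y i q xor (β xor ρ)) (trans (cong (_+ j * s) μ≡p) (sym m≡)) ⟩
        ((x m xor x q) ∧ ((x m xor y m) ∧ (x q xor y q))) xor (β xor ρ)
          ≡⟨ cong (λ c → ((x m xor x q) ∧ c) xor (β xor ρ))
               (cong₂ _∧_ (xor-≢ (μ≡p⇒differ x y μ≡p)) (xor-≢ (lcp-differ L q<L))) ⟩
        ((x m xor x q) ∧ true) xor (β xor ρ)
          ≡⟨ cong₂ (λ u v → u xor (v xor ρ)) (Bool.∧-identityʳ (x m xor x q)) (sym xβ) ⟩
        (x m xor x q) xor (x q xor ρ)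
          ≡⟨ Bool.xor-assoc (x m) (x q) _ ⟩
        x m xor (x q xor (x q xor ρ))
          ≡⟨ cong (x m xor_) (Bool.xor-assoc (x q) (x q) ρ) ⟨
        x m xor ((x q xor x q) xor ρ)
          ≡⟨ cong (λ z → x m xor (z xor ρ)) (Bool.xor-same (x q)) ⟩
        x m xor ρ ∎
        where open ≡-Reasoning

      value : ∀ {x y} → x q ≡ β → δ x y ≡ q → h x y ≡ ⌊ μ j x y ≟ p ⌋ ∧ (x m xor ρ)
      value {x} {y} xβ xy rewrite trans (mark-colour x y j′) (cong (λ i → μ i x y) j′≡) with μ j x y ≟ p
      ... | yes μ≡p = side-at-m {x} {y} xβ xy μ≡p
      ... | no _    = refl

      close-value : ∀ {x y} → x q ≡ β → δ x y ≡ q → Close x y → h x y ≡ (x m xor y m) ∧ (x m xor ρ)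
      close-value {x} {y} xβ xy cl = trans (value {x} {y} xβ xy) (cong (_∧ (x m xor ρ)) (μ-close x y cl))

      rest : ∀ {xs} → All (λ x → x q ≡ β) xs → All (λ x → All (λ y → δ x y ≡ q) (d ∷ e ∷ [])) xs →
             All (λ c → c m ≡ ρ) xs → cross h xs (d ∷ e ∷ []) ≡ false
      rest [] [] [] = refl
      rest {x ∷ xs} (xβ ∷ β′) ((xd ∷ xe ∷ []) ∷ q′) (xρ ∷ ρ′) =
        cong₂ _xor_ (cong₂ (λ u v → u xor (v xor false)) (none xd) (none xe)) (rest β′ q′ ρ′)
        where
        none : ∀ {y} → δ x y ≡ q → h x y ≡ false
        none {y} xy = trans (value {x} {y} xβ xy)
          (trans (cong (⌊ μ j x y ≟ p ⌋ ∧_) (trans (cong (_xor ρ) xρ) (Bool.xor-same ρ))) (Bool.∧-zeroʳ _))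

      -- Exactly one of `a` and `b` has a bit other than `ρ` at `m`, and exactly one of `d` and `e`
      -- differs from that vertex at `m`. So one of the four terms is true.
      square : ∀ u v w → (((u xor v) ∧ (u xor w)) xor (((u xor not v) ∧ (u xor w)) xor false)) xor
                         (((not u xor v) ∧ (not u xor w)) xor (((not u xor not v) ∧ (not u xor w)) xor false))
               ≡ true
      square true  true  true  = refl
      square true  true  false = refl
      square true  false true  = refl
      square true  false false = refl
      square false true  true  = refl
      square false true  false = refl
      square false false true  = refl
      square false false false = refl

      bm : b m ≡ not (a m)
      bm = Bool.¬-not (lcp-differ L ab<L ∘ sym)

      em : e m ≡ not (d m)
      em = Bool.¬-not (λ eq → lcp-differ L (subst (_< L) (sym de≡) ab<L)
        (subst (λ i → d i ≡ e i) (sym de≡) (sym eq)))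

      a~e : Close a e
      a~e i<p = trans (a~d i<p) (d~e i<p)
      b~d : Close b d
      b~d i<p = trans (sym (a~b i<p)) (a~d i<p)
      b~e : Close b e
      b~e i<p = trans (b~d i<p) (d~e i<p)

      total : cross h (a ∷ b ∷ cs) (d ∷ e ∷ []) ≡ true
      total = begin
        row h a (d ∷ e ∷ []) xor (row h b (d ∷ e ∷ []) xor cross h cs (d ∷ e ∷ []))
          ≡⟨ cong (λ z → row h a (d ∷ e ∷ []) xor (row h b (d ∷ e ∷ []) xor z)) (rest csβ csq csρ) ⟩
        row h a (d ∷ e ∷ []) xor (row h b (d ∷ e ∷ []) xor false)
          ≡⟨ cong (row h a (d ∷ e ∷ []) xor_) (Bool.xor-identityʳ _) ⟩
        row h a (d ∷ e ∷ []) xor row h b (d ∷ e ∷ [])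
          ≡⟨ cong₂ _xor_
               (cong₂ (λ u v → u xor (v xor false))
                 (close-value {a} {d} aβ ad a~d) (close-value {a} {e} aβ ae a~e))
               (cong₂ (λ u v → u xor (v xor false))
                 (close-value {b} {d} bβ bd b~d) (close-value {b} {e} bβ be b~e)) ⟩
        _ ≡⟨ cong₂ (λ v w → (((a m xor d m) ∧ (a m xor ρ)) xor (((a m xor w) ∧ (a m xor ρ)) xor false)) xor
                            (((v xor d m) ∧ (v xor ρ)) xor (((v xor w) ∧ (v xor ρ)) xor false))) bm em ⟩
        _ ≡⟨ square (a m) (d m) ρ ⟩
        true ∎
        where open ≡-Reasoning

  -- Testing with the indicator of `κ` makes the left side true and so forces `κ′` to be `κ`. The
  -- factor `w` accommodates a second edge that a restriction of depth might discard.
  separating⇒≡ : ∀ {κ κ′ : Colour} w → (∀ P → P κ ≡ P κ′ ∧ w) → κ ≡ κ′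
  separating⇒≡ {κ} {κ′} w all with κ Fin.≟ κ′ | all (λ c → does (κ Fin.≟ c))
  ... | yes eq | _  = eq
  ... | no _   | eq with κ Fin.≟ κ
  ...   | yes _ = case eq of λ ()
  ...   | no ne = contradiction refl ne

  pairs-2 : ∀ (P : Colour → Bool) u v → pairs (λ x y → P (colour x y)) (u ∷ v ∷ []) ≡ P (colour u v)
  pairs-2 P u v = trans (Bool.xor-identityʳ _) (Bool.xor-identityʳ _)

  -- Excluding even lists of four and five vertices

  Split-length : ∀ {l as bs d} → Split l as bs d → length as + length bs ≡ length l
  Split-length sp = sym (interleave-length (Split.shuffle sp))

  -- A 1 + 3 split has three edges across, an odd number. In a 2 + 2 split the two inner edges have
  -- the same colour and `rectangle` applies; with no further vertex the choice of `ρ` is arbitrary.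
  no-even-4 : ∀ {l} → length l ≡ 4 → Distinct l → ¬ Even l
  no-even-4 {l@(x ∷ y ∷ l′)} len dist even =
    let _ , _ , _ , sp = split x y l′ dist in analyse sp (trans (Split-length sp) len)
    where
    analyse : ∀ {as bs d} → Split l as bs d → length as + length bs ≡ 4 → ⊥
    analyse {[]}                 sp n = Split.nonemptyˡ sp refl
    analyse {as}                 {[]}                 sp n = Split.nonemptyʳ sp refl
    analyse {_ ∷ []}         {_ ∷ _ ∷ _ ∷ []} sp n = case across-even even sp (λ _ → true) of λ ()
    analyse {_ ∷ _ ∷ _ ∷ []} {_ ∷ []}         sp n = case across-even even sp (λ _ → true) of λ ()
    analyse {a ∷ b ∷ []}     {d ∷ e ∷ []}     sp n =
      rectangle ab~de ab<L true d<L bitˡ across [] (across-even even sp)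
      where
      open Split sp
      ab~de : colour a b ≡ colour d e
      ab~de = separating⇒≡ true (λ P → trans (sym (pairs-2 P a b))
        (trans (within-even even sp P) (trans (pairs-2 P d e) (sym (Bool.∧-identityʳ _)))))
      ab<L : δ a b < L
      ab<L with (ab<L ∷ []) ∷ _ ← AllPairs-interleaveˡ shuffle dist = ab<L
    analyse {_ ∷ _ ∷ _ ∷ _ ∷ as} {_ ∷ bs} sp n =
      contradiction (≤-reflexive (trans (sym (+-suc (4 + length as) (length bs))) n))
        λ { (s≤s (s≤s (s≤s (s≤s ())))) }

  -- A single vertex spans no edges, so the side of four would be even by itself.
  no-split-4-1 : ∀ {l as b d} → Distinct l → Even l → Split l as (b ∷ []) d → length as ≢ 4
  no-split-4-1 dist even sp len =
    no-even-4 len (AllPairs-interleaveˡ (Split.shuffle sp) dist) (within-even even sp)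

  -- The triangle splits again, into `a`, `b` and a vertex `c`. The edges at `c` have the depth `r`
  -- of this second split and `ab` does not, so discarding depth `r` leaves `ab` alone against `de`:
  -- these two share a colour, and `rectangle` applies with `c` as the further vertex.
  no-split-3-2 : ∀ {l x y z d e q} → Distinct l → Even l → ¬ Split l (x ∷ y ∷ z ∷ []) (d ∷ e ∷ []) q
  no-split-3-2 {l} {x} {y} {z} {d} {e} {q} dist even sp =
    let _ , _ , _ , sp′ = split x y (z ∷ []) distT in analyse sp′ (Split-length sp′)
    where
    T : List Bits
    T = x ∷ y ∷ z ∷ []

    distT : Distinct T
    distT = AllPairs-interleaveˡ (Split.shuffle sp) dist

    two-one : ∀ {a b c r} → ¬ Split T (a ∷ b ∷ []) (c ∷ []) r
    two-one {a} {b} {c} {r} sp′ =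
      -- Taking for `ρ` the bit of `c` at the first difference of `a` and `b` makes the edges at `c`
      -- contribute nothing.
      rectangle ab~de (All.lookup (AllPairs.head abDist) (here refl)) (c (δ a b)) (Split.d<L sp)
        (reorder (Split.bitˡ sp)) (reorder (Split.across sp)) (refl ∷ []) crossed
      where
      open Split sp′
      open ≡-Reasoning

      abDist : Distinct (a ∷ b ∷ [])
      abDist = AllPairs-interleaveˡ shuffle distT

      reorder : ∀ {Q : Bits → Set} → All Q T → All Q (a ∷ b ∷ c ∷ [])
      reorder qs with qa ∷ qb ∷ [] ← All-interleaveˡ shuffle qs
                    | qc ∷ [] ← All-interleaveˡ (swap shuffle) qs = qa ∷ qb ∷ qc ∷ []

      ab~de : colour a b ≡ colour d e
      ab~de = separating⇒≡ (not ⌊ depth (colour d e) ≟ r ⌋) λ P →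
        let h = λ u v → except r P (colour u v) in begin
        P (colour a b)
          ≡⟨ except-≢ P {a} {b} (All.lookup (AllPairs.head (same-bit d<L bitˡ)) (here refl)) ⟨
        h a b
          ≡⟨ pairs-2 (except r P) a b ⟨
        pairs h (a ∷ b ∷ [])
          ≡⟨ trans (Bool.xor-identityʳ _) (Bool.xor-identityʳ _) ⟨
        (pairs h (a ∷ b ∷ []) xor pairs h (c ∷ [])) xor false
          ≡⟨ cong ((pairs h (a ∷ b ∷ []) xor false) xor_)
               (trans (cross-cong (All.map (All.map (except-≡ P)) across))
                      (cross-false (a ∷ b ∷ []) (c ∷ []))) ⟨
        (pairs h (a ∷ b ∷ []) xor pairs h (c ∷ [])) xor cross h (a ∷ b ∷ []) (c ∷ [])
          ≡⟨ pairs-interleave h (P-sym (except r P)) shuffle ⟨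
        pairs h T
          ≡⟨ within-even even sp (except r P) ⟩
        pairs h (d ∷ e ∷ [])
          ≡⟨ pairs-2 (except r P) d e ⟩
        h d e ∎

      crossed : ∀ (P : Colour → Bool) →
                cross (λ u v → P (colour u v)) (a ∷ b ∷ c ∷ []) (d ∷ e ∷ []) ≡ false
      crossed P = let h = λ u v → P (colour u v); de = d ∷ e ∷ [] in begin
        row h a de xor (row h b de xor cross h (c ∷ []) de)
          ≡⟨ cong (λ w → row h a de xor (w xor cross h (c ∷ []) de)) (Bool.xor-identityʳ (row h b de)) ⟨
        row h a de xor ((row h b de xor false) xor cross h (c ∷ []) de)
          ≡⟨ Bool.xor-assoc (row h a de) (row h b de xor false) (cross h (c ∷ []) de) ⟨
        cross h (a ∷ b ∷ []) de xor cross h (c ∷ []) de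
          ≡⟨ cross-interleave h de shuffle ⟨
        cross h T de
          ≡⟨ across-even even sp P ⟩
        false ∎

    analyse : ∀ {as bs r} → Split T as bs r → length as + length bs ≡ 3 → ⊥
    analyse {[]}                  sp′ n = Split.nonemptyˡ sp′ refl
    analyse {as}          {[]}    sp′ n = Split.nonemptyʳ sp′ refl
    analyse {_ ∷ []}     {_ ∷ _ ∷ []} sp′ n = two-one (Split-swap sp′)
    analyse {_ ∷ _ ∷ []} {_ ∷ []}     sp′ n = two-one sp′
    analyse {_ ∷ _ ∷ _ ∷ as} {_ ∷ bs} sp′ n =
      contradiction (≤-reflexive (trans (sym (+-suc (3 + length as) (length bs))) n))
        λ { (s≤s (s≤s (s≤s ()))) }

  no-even-5 : ∀ {l} → length l ≡ 5 → Distinct l → ¬ Even l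
  no-even-5 {l@(x ∷ y ∷ l′)} len dist even =
    let _ , _ , _ , sp = split x y l′ dist in analyse sp (trans (Split-length sp) len)
    where
    analyse : ∀ {as bs d} → Split l as bs d → length as + length bs ≡ 5 → ⊥
    analyse {[]}                 sp n = Split.nonemptyˡ sp refl
    analyse {as}                 {[]}                 sp n = Split.nonemptyʳ sp refl
    analyse {_ ∷ []}         {_ ∷ _ ∷ _ ∷ _ ∷ []} sp n = no-split-4-1 dist even (Split-swap sp) refl
    analyse {_ ∷ _ ∷ _ ∷ _ ∷ []} {_ ∷ []}         sp n = no-split-4-1 dist even sp refl
    analyse {_ ∷ _ ∷ []} {_ ∷ _ ∷ _ ∷ []}         sp n = no-split-3-2 dist even (Split-swap sp)
    analyse {_ ∷ _ ∷ _ ∷ []} {_ ∷ _ ∷ []}         sp n = no-split-3-2 dist even sp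
    analyse {_ ∷ _ ∷ _ ∷ _ ∷ _ ∷ as} {_ ∷ bs} sp n =
      contradiction (≤-reflexive (trans (sym (+-suc (5 + length as) (length bs))) n))
        λ { (s≤s (s≤s (s≤s (s≤s (s≤s ()))))) }

-- Codes from colourings

module _ {c ℓ} (M : CommutativeMonoid c ℓ) where
  open CommutativeMonoid M using (Carrier; _≈_; _∙_; ε; ∙-congˡ; identityʳ)
  open MonoidSum M

  sum-single : ∀ {n} (t : Fin n → Carrier) i → (∀ k → k ≢ i → t k ≈ ε) → sum t ≈ t i
  sum-single {suc n} t i others = begin
    sum t                          ≈⟨ sum-remove t ⟩
    t i ∙ sum (t ∘ Fin.punchIn i)  ≈⟨ ∙-congˡ (sum-cong-≋ (λ k → others _ (Fin.punchInᵢ≢i i k))) ⟩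
    t i ∙ sum {n} (λ _ → ε)        ≈⟨ ∙-congˡ (sum-replicate-zero n) ⟩
    t i ∙ ε                        ≈⟨ identityʳ (t i) ⟩
    t i ∎
    where open SetoidReasoning (CommutativeMonoid.setoid M)

module ⊕ = MonoidSum (CommutativeRing.+-commutativeMonoid Bool.xor-∧-commutativeRing)
module ∑ = SemiringSum ℤ.+-*-semiring

pairs-ext : ∀ {h h′ : A → A → Bool} → (∀ x y → h x y ≡ h′ x y) → ∀ xs → pairs h xs ≡ pairs h′ xs
pairs-ext e xs = pairs-cong (universal xs)
  where
  universal : ∀ xs → AllPairs (λ x y → _ ≡ _) xs
  universal []       = []
  universal (x ∷ xs) = All.universal (e x) xs ∷ universal xs

pairs-sum : ∀ {m} (g : Fin m → A → A → Bool) xs →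
            pairs (λ u v → ⊕.sum (λ κ → g κ u v)) xs ≡ ⊕.sum (λ κ → pairs (g κ) xs)
pairs-sum {m = zero}  g xs = pairs-false xs
pairs-sum {m = suc m} g xs = trans (pairs-xor (g Fin.zero) _ xs)
  (cong (pairs (g Fin.zero) xs xor_) (pairs-sum (g ∘ Fin.suc) xs))

-- A set of colours is the sum modulo 2 of the singletons it contains, and `pairs` is additive.
even-classes⇒even : ∀ {m} (c : A → A → Fin m) xs →
                    (∀ κ → pairs (λ u v → does (c u v Fin.≟ κ)) xs ≡ false) →
                    ∀ (P : Fin m → Bool) → pairs (λ u v → P (c u v)) xs ≡ false
even-classes⇒even {A = A} {m} c xs even P = begin
  pairs (λ u v → P (c u v)) xs             ≡⟨ pairs-ext expand xs ⟩
  pairs (λ u v → ⊕.sum (λ κ → g κ u v)) xs ≡⟨ pairs-sum g xs ⟩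
  ⊕.sum (λ κ → pairs (g κ) xs)             ≡⟨ ⊕.sum-cong-≗ class ⟩
  ⊕.sum {m} (λ _ → false)                  ≡⟨ ⊕.sum-replicate-zero m ⟩
  false ∎
  where
  open ≡-Reasoning
  g : Fin m → A → A → Bool
  g κ u v = P κ ∧ does (c u v Fin.≟ κ)
  diagonal : ∀ i → P i ∧ does (i Fin.≟ i) ≡ P i
  diagonal i with i Fin.≟ i
  ... | yes _ = Bool.∧-identityʳ _
  ... | no ne = contradiction refl ne
  offDiagonal : ∀ i κ → κ ≢ i → P κ ∧ does (i Fin.≟ κ) ≡ false
  offDiagonal i κ κ≢i with i Fin.≟ κ
  ... | yes e = contradiction (sym e) κ≢i
  ... | no _  = Bool.∧-zeroʳ _
  expand : ∀ u v → P (c u v) ≡ ⊕.sum (λ κ → g κ u v)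
  expand u v = sym (trans (sum-single (CommutativeRing.+-commutativeMonoid Bool.xor-∧-commutativeRing)
                             (λ κ → g κ u v) (c u v) (offDiagonal (c u v))) (diagonal (c u v)))
  class : ∀ κ → pairs (g κ) xs ≡ false
  class κ with P κ
  ... | true  = even κ
  ... | false = pairs-false xs

-- A Vandermonde argument: multiplying the coefficients by κ - z removes z from the support
-- and lowers the number of available power sums by one.
power-sums-vanish : ∀ {m} (zs : List (Fin m)) (a : Fin m → ℤ) → (∀ κ → a κ ≢ 0ℤ → κ ∈ zs) →
                    (∀ j → j < length zs → ∑.sum (λ κ → a κ ℤ.* (+ toℕ κ) ℤ.^ j) ≡ 0ℤ) →
                    ∀ κ → a κ ≡ 0ℤ
power-sums-vanish [] a support _ κ with a κ ℤ.≟ 0ℤ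
... | yes e = e
... | no ne = case support κ ne of λ ()
power-sums-vanish {m} (z ∷ zs) a support sums κ with a κ ℤ.≟ 0ℤ
... | yes e = e
-- By `only-z` the point `κ` is `z` and every other coefficient vanishes, so the power sum of order
-- 0 is `a κ`.
... | no ne = contradiction (begin
  a κ
    ≡⟨ ℤ.*-identityʳ (a κ) ⟨
  a κ ℤ.* + 1
    ≡⟨ sum-single ℤ.+-0-commutativeMonoid (λ κ′ → a κ′ ℤ.* + 1) κ
         (λ κ′ κ′≢κ → cong (ℤ._* + 1) (elsewhere κ′ κ′≢κ)) ⟨
  ∑.sum (λ κ′ → a κ′ ℤ.* + 1)
    ≡⟨ sums 0 z<s ⟩
  0ℤ ∎) ne
  where
  open ≡-Reasoning
  pt : Fin m → ℤ
  pt κ = + toℕ κ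
  b : Fin m → ℤ
  b κ = a κ ℤ.* (pt κ ℤ.- pt z)

  b-support : ∀ κ → b κ ≢ 0ℤ → κ ∈ zs
  b-support κ b≢0 with support κ (λ a≡0 → b≢0 (cong (ℤ._* (pt κ ℤ.- pt z)) a≡0))
  ... | here refl = contradiction (trans (cong (a κ ℤ.*_) (ℤ.+-inverseʳ (pt κ))) (ℤ.*-zeroʳ (a κ))) b≢0
  ... | there κ∈  = κ∈

  expand : ∀ j κ → b κ ℤ.* pt κ ℤ.^ j ≡ a κ ℤ.* pt κ ℤ.^ suc j ℤ.+ ℤ.- pt z ℤ.* (a κ ℤ.* pt κ ℤ.^ j)
  expand j κ = solve 4 (λ a p z q → a :* (p :- z) :* q := a :* (p :* q) :+ (:- z) :* (a :* q)) refl
    (a κ) (pt κ) (pt z) (pt κ ℤ.^ j)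
    where open ℤ.+-*-Solver

  b-sums : ∀ j → j < length zs → ∑.sum (λ κ → b κ ℤ.* pt κ ℤ.^ j) ≡ 0ℤ
  b-sums j j< = begin
    ∑.sum (λ κ → b κ ℤ.* pt κ ℤ.^ j)
      ≡⟨ ∑.sum-cong-≗ (expand j) ⟩
    ∑.sum (λ κ → a κ ℤ.* pt κ ℤ.^ suc j ℤ.+ ℤ.- pt z ℤ.* (a κ ℤ.* pt κ ℤ.^ j))
      ≡⟨ ∑.∑-distrib-+ (λ κ → a κ ℤ.* pt κ ℤ.^ suc j) (λ κ → ℤ.- pt z ℤ.* (a κ ℤ.* pt κ ℤ.^ j)) ⟩
    ∑.sum (λ κ → a κ ℤ.* pt κ ℤ.^ suc j) ℤ.+ ∑.sum (λ κ → ℤ.- pt z ℤ.* (a κ ℤ.* pt κ ℤ.^ j))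
      ≡⟨ cong₂ ℤ._+_ (sums (suc j) (s≤s j<))
           (trans (sym (∑.*-distribˡ-sum (ℤ.- pt z) (λ κ → a κ ℤ.* pt κ ℤ.^ j)))
                  (cong (ℤ.- pt z ℤ.*_) (sums j (m<n⇒m<1+n j<)))) ⟩
    0ℤ ℤ.+ ℤ.- pt z ℤ.* 0ℤ
      ≡⟨ trans (ℤ.+-identityˡ _) (ℤ.*-zeroʳ (ℤ.- pt z)) ⟩
    0ℤ ∎

  only-z : ∀ κ → a κ ≢ 0ℤ → κ ≡ z
  only-z κ a≢0 with ℤ.i*j≡0⇒i≡0∨j≡0 (a κ) (power-sums-vanish zs b b-support b-sums κ)
  ... | inj₁ a≡0 = contradiction a≡0 a≢0
  ... | inj₂ p≡0 = Fin.toℕ-injective (ℤ.+-injective (ℤ.i-j≡0⇒i≡j (pt κ) (pt z) p≡0))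

  elsewhere : ∀ κ′ → κ′ ≢ κ → a κ′ ≡ 0ℤ
  elsewhere κ′ κ′≢κ with a κ′ ℤ.≟ 0ℤ
  ... | yes e   = e
  ... | no a′≢0 = contradiction (trans (only-z κ′ a′≢0) (sym (only-z κ ne))) κ′≢κ

-- Power sums of sets of colours

module +-Sum = MonoidSum +-0-commutativeMonoid

-- As `0 ^ 0` is 1, the sum of order 0 is the cardinality of the set, also when colour 0 belongs to
-- it.
powerSum : ∀ {m} → (Fin m → Bool) → ℕ → ℕ
powerSum X j = +-Sum.sum (λ κ → if X κ then toℕ κ ^ j else 0)

sum≤ : ∀ {m b} (f : Fin m → ℕ) → (∀ κ → f κ ≤ b) → +-Sum.sum f ≤ m * b
sum≤ {zero}  f f≤b = z≤n
sum≤ {suc m} f f≤b = +-mono-≤ (f≤b Fin.zero) (sum≤ (f ∘ Fin.suc) (f≤b ∘ Fin.suc))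

powerSum≤ : ∀ {m} .{{_ : NonZero m}} (X : Fin m → Bool) {j r} → j < r → powerSum X j ≤ m ^ r
powerSum≤ {m} X {j} j<r = ≤-trans (sum≤ _ term) (^-monoʳ-≤ m j<r)
  where
  term : ∀ κ → (if X κ then toℕ κ ^ j else 0) ≤ m ^ j
  term κ with X κ
  ... | true  = ^-monoˡ-≤ j (<⇒≤ (Fin.toℕ<n κ))
  ... | false = z≤n

pos-sum : ∀ {m} (f : Fin m → ℕ) → + +-Sum.sum f ≡ ∑.sum (λ κ → + f κ)
pos-sum {zero}  f = refl
pos-sum {suc m} f = trans (ℤ.pos-+ (f Fin.zero) _) (cong (ℤ._+_ (+ f Fin.zero)) (pos-sum (f ∘ Fin.suc)))

pos-^ : ∀ a j → + (a ^ j) ≡ (+ a) ℤ.^ j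
pos-^ a zero    = refl
pos-^ a (suc j) = trans (ℤ.pos-* a (a ^ j)) (cong (ℤ._*_ (+ a)) (pos-^ a j))

indicator : Bool → ℤ
indicator b = if b then + 1 else 0ℤ

pos-powerSum : ∀ {m} (X : Fin m → Bool) j →
               + powerSum X j ≡ ∑.sum (λ κ → indicator (X κ) ℤ.* (+ toℕ κ) ℤ.^ j)
pos-powerSum X j = trans (pos-sum (λ κ → if X κ then toℕ κ ^ j else 0)) (∑.sum-cong-≗ term)
  where
  term : ∀ κ → + (if X κ then toℕ κ ^ j else 0) ≡ indicator (X κ) ℤ.* (+ toℕ κ) ℤ.^ j
  term κ with X κ
  ... | true  = trans (pos-^ (toℕ κ) j) (sym (ℤ.*-identityˡ _))
  ... | false = refl

-- The difference of the two indicators has support in `zs`, and its first `length zs` power sums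
-- vanish.
powerSums-separate : ∀ {m} (X Y : Fin m → Bool) zs → (∀ κ → X κ ≢ Y κ → κ ∈ zs) →
                     (∀ j → j < length zs → powerSum X j ≡ powerSum Y j) → X ≗ Y
powerSums-separate {m} X Y zs support sums κ =
  indicator-injective (ℤ.i-j≡0⇒i≡j _ _ (power-sums-vanish zs a a-support a-sums κ))
  where
  indicator-injective : ∀ {b c} → indicator b ≡ indicator c → b ≡ c
  indicator-injective {true}  {true}  _ = refl
  indicator-injective {false} {false} _ = refl
  a : Fin m → ℤ
  a κ = indicator (X κ) ℤ.- indicator (Y κ)
  a-support : ∀ κ → a κ ≢ 0ℤ → κ ∈ zs
  a-support κ a≢0 = support κ (λ e → a≢0 (ℤ.i≡j⇒i-j≡0 (cong indicator e)))
  a-sums : ∀ j → j < length zs → ∑.sum (λ κ → a κ ℤ.* (+ toℕ κ) ℤ.^ j) ≡ 0ℤ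
  a-sums j j< = begin
    ∑.sum (λ κ → a κ ℤ.* p κ)
      ≡⟨ ∑.sum-cong-≗ (λ κ →
           solve 3 (λ x y q → (x :- y) :* q := x :* q :+ con ℤ.-1ℤ :* (y :* q)) refl
             (indicator (X κ)) (indicator (Y κ)) (p κ)) ⟩
    ∑.sum (λ κ → indicator (X κ) ℤ.* p κ ℤ.+ ℤ.-1ℤ ℤ.* (indicator (Y κ) ℤ.* p κ))
      ≡⟨ ∑.∑-distrib-+ (λ κ → indicator (X κ) ℤ.* p κ) (λ κ → ℤ.-1ℤ ℤ.* (indicator (Y κ) ℤ.* p κ)) ⟩
    ∑.sum (λ κ → indicator (X κ) ℤ.* p κ) ℤ.+ ∑.sum (λ κ → ℤ.-1ℤ ℤ.* (indicator (Y κ) ℤ.* p κ))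
      ≡⟨ cong₂ ℤ._+_ (pos-powerSum X j)
           (trans (cong (ℤ.-1ℤ ℤ.*_) (pos-powerSum Y j))
                  (∑.*-distribˡ-sum ℤ.-1ℤ (λ κ → indicator (Y κ) ℤ.* p κ))) ⟨
    + powerSum X j ℤ.+ ℤ.-1ℤ ℤ.* + powerSum Y j
      ≡⟨ cong (ℤ._+_ (+ powerSum X j)) (ℤ.-1*i≡-i (+ powerSum Y j)) ⟩
    + powerSum X j ℤ.- + powerSum Y j
      ≡⟨ ℤ.i≡j⇒i-j≡0 (cong +_ (sums j j<)) ⟩
    0ℤ ∎
    where
    open ≡-Reasoning
    open ℤ.+-*-Solver
    p : Fin m → ℤ
    p κ = (+ toℕ κ) ℤ.^ j

module _ {m} .{{_ : NonZero m}} (r : ℕ) where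

  -- An integer analogue of the syndrome of a BCH code: `r` power sums, each at most `m ^ r`, packed
  -- as digits in base `suc (m ^ r)`.
  syndrome : (Fin m → Bool) → Fin (suc (m ^ r) ^ r)
  syndrome X = funToFin (λ (j : Fin r) → fromℕ< (s≤s (powerSum≤ X (Fin.toℕ<n j))))

  syndrome-separates : ∀ X Y zs → length zs ≤ r → (∀ κ → X κ ≢ Y κ → κ ∈ zs) →
                       syndrome X ≡ syndrome Y → X ≗ Y
  syndrome-separates X Y zs len support eq =
    powerSums-separate X Y zs support (λ j j< → sums j (<-≤-trans j< len))
    where
    entry : ∀ Z (j : Fin r) → toℕ (finToFun (syndrome Z) j) ≡ powerSum Z (toℕ j)
    entry Z j = trans
      (cong toℕ (Fin.finToFun-funToFin (λ j → fromℕ< (s≤s (powerSum≤ Z (Fin.toℕ<n j)))) j))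
      (Fin.toℕ-fromℕ< _)
    sums : ∀ j → j < r → powerSum X j ≡ powerSum Y j
    sums j j<r = subst (λ i → powerSum X i ≡ powerSum Y i) (Fin.toℕ-fromℕ< j<r)
      (trans (sym (entry X (fromℕ< j<r)))
        (trans (cong (λ σ → toℕ (finToFun σ (fromℕ< j<r))) eq) (entry Y (fromℕ< j<r))))

-- Parities of the colour classes of a graph

pairs-map : ∀ {B : Set} (h : B → B → Bool) (f : A → B) xs →
            pairs h (map f xs) ≡ pairs (λ x y → h (f x) (f y)) xs
pairs-map h f []       = refl
pairs-map h f (x ∷ xs) = cong₂ _xor_ (row-map xs) (pairs-map h f xs)
  where
  row-map : ∀ ys → row h (f x) (map f ys) ≡ row (λ x y → h (f x) (f y)) x ys
  row-map []       = refl
  row-map (y ∷ ys) = cong (h (f x) (f y) xor_) (row-map ys)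

row-filter : ∀ {P : A → Set} (P? : Decidable P) (h : A → A → Bool) x ys →
             row h x (filter P? ys) ≡ row (λ u v → does (P? v) ∧ h u v) x ys
row-filter P? h x [] = refl
row-filter P? h x (y ∷ ys) with does (P? y)
... | true  = cong (h x y xor_) (row-filter P? h x ys)
... | false = row-filter P? h x ys

pairs-filter : ∀ {P : A → Set} (P? : Decidable P) (h : A → A → Bool) xs →
               pairs h (filter P? xs) ≡ pairs (λ u v → (does (P? u) ∧ does (P? v)) ∧ h u v) xs
pairs-filter P? h [] = refl
pairs-filter P? h (x ∷ xs) with does (P? x) in eq
... | true  = cong₂ _xor_ (trans (row-filter P? h x xs) (row-cong (All.universal select xs)))
                          (pairs-filter P? h xs)
  where
  select : ∀ y → does (P? y) ∧ h x y ≡ (does (P? x) ∧ does (P? y)) ∧ h x y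
  select y = cong (λ b → (b ∧ does (P? y)) ∧ h x y) (sym eq)
... | false = cong₂ _xor_ (sym (trans (row-cong (All.universal reject xs)) (row-false x xs)))
                          (pairs-filter P? h xs)
  where
  reject : ∀ y → (does (P? x) ∧ does (P? y)) ∧ h x y ≡ false
  reject y = cong (λ b → (b ∧ does (P? y)) ∧ h x y) eq

pairColours : ∀ {B : Set} → (A → A → B) → List A → List B
pairColours c []       = []
pairColours c (x ∷ xs) = map (c x) xs ++ pairColours c xs

pairs-support : ∀ {m} (c : A → A → Fin m) xs κ →
                pairs (λ u v → does (c u v Fin.≟ κ)) xs ≢ false → κ ∈ pairColours c xs
pairs-support c []       κ ne = contradiction refl ne
pairs-support c (x ∷ xs) κ ne with row (λ u v → does (c u v Fin.≟ κ)) x xs Bool.≟ false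
... | yes e  = ∈.∈-++⁺ʳ (map (c x) xs) (pairs-support c xs κ (λ e′ → ne (cong₂ _xor_ e e′)))
... | no ne′ = ∈.∈-++⁺ˡ (row-support xs ne′)
  where
  row-support : ∀ ys → row (λ u v → does (c u v Fin.≟ κ)) x ys ≢ false → κ ∈ map (c x) ys
  row-support [] ne = contradiction refl ne
  row-support (y ∷ ys) ne with c x y Fin.≟ κ
  ... | yes e = here (sym e)
  ... | no _  = there (row-support ys ne)

length-pairColours : ∀ {B : Set} (c : A → A → B) {xs} → length xs ≡ 5 → length (pairColours c xs) ≡ 10
length-pairColours c {_ ∷ _ ∷ _ ∷ _ ∷ _ ∷ []} _ = refl

⇔⇒≡-does-∧ : ∀ {P Q : Set} {b} → (b ≡ true) ⇔ (P × Q) → (p? : Dec P) (q? : Dec Q) →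
             b ≡ does p? ∧ does q?
⇔⇒≡-does-∧ {b = true}  iff (yes _) (yes _) = refl
⇔⇒≡-does-∧ {b = true}  iff (no ¬p) _       = contradiction (proj₁ (Equivalence.to iff refl)) ¬p
⇔⇒≡-does-∧ {b = true}  iff (yes _) (no ¬q) = contradiction (proj₂ (Equivalence.to iff refl)) ¬q
⇔⇒≡-does-∧ {b = false} iff (yes p) (yes q) = Equivalence.from iff (p , q)
⇔⇒≡-does-∧ {b = false} iff (yes _) (no _)  = refl
⇔⇒≡-does-∧ {b = false} iff (no _)  _       = refl

module _ {n m} (c : Fin n → Fin n → Fin m) where

  -- Since `allFin n` is increasing, only the meaningful entries `G i j` with `i` before `j` are
  -- read.
  parity : Graph n → Fin m → Bool
  parity G κ = pairs (λ i j → G i j ∧ does (c i j Fin.≟ κ)) (allFin n)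

  parity-symDiff : ∀ G G′ κ → parity (symDiff G G′) κ ≡ parity G κ xor parity G′ κ
  parity-symDiff G G′ κ = trans
    (pairs-ext (λ i j → Bool.∧-distribʳ-xor (does (c i j Fin.≟ κ)) (G i j) (G′ i j)) (allFin n))
    (pairs-xor (λ i j → G i j ∧ does (c i j Fin.≟ κ)) (λ i j → G′ i j ∧ does (c i j Fin.≟ κ)) (allFin n))

  allFin-< : AllPairs (λ i j → toℕ i < toℕ j) (allFin n)
  allFin-< = AllPairs.tabulate⁺-< (λ i<j → i<j)

  -- The image of `f` is listed in the order of `allFin n`, so that its pairs are pairs on which `S`
  -- is specified. The length is 5 because this list and `tabulate f` are free of repetitions and
  -- have the same members, hence are permutations of each other.
  K5-vertices : ∀ {S} → IsK5 S → ∃[ vs ] (length vs ≡ 5 × Unique vs ×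
                (∀ κ → parity S κ ≡ pairs (λ i j → does (c i j Fin.≟ κ)) vs))
  K5-vertices {S} (f , f-inj , edges) = vs , len , vs-unique , λ κ →
    trans (pairs-cong (AllPairs.map (λ {i} {j} i<j → cong (_∧ does (c i j Fin.≟ κ)) (edge i<j)) allFin-<))
          (sym (pairs-filter image? (λ i j → does (c i j Fin.≟ κ)) (allFin n)))
    where
    image? : Decidable (λ i → ∃[ a ] f a ≡ i)
    image? i = Fin.any? (λ a → f a Fin.≟ i)
    vs : List (Fin n)
    vs = filter image? (allFin n)
    vs-unique : Unique vs
    vs-unique = Unique.filter⁺ image? (Unique.allFin⁺ n)
    ∈vs⇔∈image : ∀ {v} → v ∈ vs ⇔ v ∈ tabulate f
    ∈vs⇔∈image = mk⇔
      (λ v∈ → case ∈.∈-filter⁻ image? {xs = allFin n} v∈ of λ { (_ , a , refl) → ∈.∈-tabulate⁺ {f = f} a })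
      (λ v∈ → case ∈.∈-tabulate⁻ {f = f} v∈ of λ { (a , refl) → ∈.∈-filter⁺ image? (∈.∈-allFin _) (a , refl) })
    len : length vs ≡ 5
    len = trans
      (↭-length (∼bag⇒↭ (unique∧set⇒bag vs-unique (Unique.tabulate⁺ {f = f} f-inj) ∈vs⇔∈image)))
      (length-tabulate f)
    edge : ∀ {i j} → toℕ i < toℕ j → S i j ≡ does (image? i) ∧ does (image? j)
    edge {i} {j} i<j = ⇔⇒≡-does-∧ (edges i j i<j) (image? i) (image? j)

  module _ .{{_ : NonZero m}}
           (odd-class : ∀ {vs} → length vs ≡ 5 → Unique vs →
                        ¬ (∀ κ → pairs (λ i j → does (c i j Fin.≟ κ)) vs ≡ false)) where

    -- The parities of `G` and `G′` differ precisely at the odd colour classes of the K₅, which are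
    -- among the colours of its 10 edges. Equal syndromes would thus make the parities equal and all
    -- classes even.
    syndrome-K5 : ∀ G G′ → syndrome 10 (parity G) ≡ syndrome 10 (parity G′) → ¬ IsK5 (symDiff G G′)
    syndrome-K5 G G′ eq k5 with vs , len , unique , classes ← K5-vertices k5 =
      odd-class len unique λ κ → begin
        pairs (λ i j → does (c i j Fin.≟ κ)) vs ≡⟨ difference κ ⟨
        parity G κ xor parity G′ κ              ≡⟨ cong (_xor parity G′ κ) (same κ) ⟩
        parity G′ κ xor parity G′ κ             ≡⟨ Bool.xor-same (parity G′ κ) ⟩
        false ∎
      where
      open ≡-Reasoning
      difference : ∀ κ → parity G κ xor parity G′ κ ≡ pairs (λ i j → does (c i j Fin.≟ κ)) vs
      difference κ = trans (sym (parity-symDiff G G′ κ)) (classes κ)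
      same : parity G ≗ parity G′
      same = syndrome-separates 10 (parity G) (parity G′) (pairColours c vs)
        (≤-reflexive (length-pairColours c {vs} len))
        (λ κ ne → pairs-support c vs κ (λ e → ne (xor-cancelˡ (trans (difference κ) e)))) eq

-- Listing all graphs

AllPairs-cartesianProductWith :
  ∀ {A B E : Set} {R : A → A → Set} {S : B → B → Set} {T : E → E → Set} (f : A → B → E) →
  (∀ {x x′ y y′} → R x x′ → T (f x y) (f x′ y′)) → (∀ {x y y′} → S y y′ → T (f x y) (f x y′)) →
  ∀ {xs ys} → AllPairs R xs → AllPairs S ys → AllPairs T (cartesianProductWith f xs ys)
AllPairs-cartesianProductWith f left right [] ys! = []
AllPairs-cartesianProductWith {R = R} {T = T} f left right {x ∷ xs} {ys} (px ∷ xs!) ys! =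
  AllPairs.++⁺ (AllPairs.map⁺ (AllPairs.map right ys!)) (AllPairs-cartesianProductWith f left right xs! ys!)
               (All.map⁺ (All.universal (λ y → apart y px) ys))
  where
  apart : ∀ y {xs} → All (R x) xs → All (T (f x y)) (cartesianProductWith f xs ys)
  apart y []       = []
  apart y (p ∷ ps) = All.++⁺ (All.map⁺ (All.universal (λ _ → left p) ys)) (apart y ps)

length-cartesianProductWith : ∀ {A B E : Set} (f : A → B → E) xs ys →
                              length (cartesianProductWith f xs ys) ≡ length xs * length ys
length-cartesianProductWith f []       ys = refl
length-cartesianProductWith f (x ∷ xs) ys = trans (length-++ (map (f x) ys))
  (cong₂ _+_ (length-map (f x) ys) (length-cartesianProductWith f xs ys))

boolVectors : ∀ n → List (Vector Bool n)
boolVectors zero    = Vector.[] ∷ []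
boolVectors (suc n) = cartesianProductWith Vector._∷_ (true ∷ false ∷ []) (boolVectors n)

length-boolVectors : ∀ n → length (boolVectors n) ≡ 2 ^ n
length-boolVectors zero    = refl
length-boolVectors (suc n) =
  trans (length-cartesianProductWith Vector._∷_ (true ∷ false ∷ []) (boolVectors n))
        (cong (2 *_) (length-boolVectors n))

boolVectors-distinct : ∀ n → AllPairs (λ u v → ∃[ i ] u i ≢ v i) (boolVectors n)
boolVectors-distinct zero    = [] ∷ []
boolVectors-distinct (suc n) = AllPairs-cartesianProductWith {R = _≢_} Vector._∷_
  (λ ne → Fin.zero , ne) (λ (i , ne) → Fin.suc i , ne) (((λ ()) ∷ []) ∷ [] ∷ []) (boolVectors-distinct n)

-- The new vertex is `zero`, with neighbourhood `r`, and the old ones move up by one. Column `zero`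
-- holds only ignored entries; filling these with `false` gives each graph one representative in
-- `graphs`.
addVertex : ∀ {n} → Vector Bool n → Graph n → Graph (suc n)
addVertex r G Fin.zero    (Fin.suc j) = r j
addVertex r G (Fin.suc i) (Fin.suc j) = G i j
addVertex r G _           Fin.zero    = false

graphs : ∀ n → List (Graph n)
graphs zero    = (λ ()) ∷ []
graphs (suc n) = cartesianProductWith addVertex (boolVectors n) (graphs n)

length-graphs : ∀ n → length (graphs n) ≡ 2 ^ (n C 2)
length-graphs zero    = refl
length-graphs (suc n) = begin
  length (graphs (suc n))
    ≡⟨ length-cartesianProductWith addVertex (boolVectors n) (graphs n) ⟩
  length (boolVectors n) * length (graphs n)
    ≡⟨ cong₂ _*_ (length-boolVectors n) (length-graphs n) ⟩
  2 ^ n * 2 ^ (n C 2)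
    ≡⟨ ^-distribˡ-+-* 2 n (n C 2) ⟨
  2 ^ (n + n C 2)
    ≡⟨ cong (λ e → 2 ^ (e + n C 2)) (nC1≡n n) ⟨
  2 ^ (n C 1 + n C 2)
    ≡⟨ cong (2 ^_) (nCk+nC[k+1]≡[n+1]C[k+1] n 1) ⟩
  2 ^ (suc n C 2) ∎
  where open ≡-Reasoning

graphs-distinct : ∀ n → AllPairs DifferentGraphs (graphs n)
graphs-distinct zero    = [] ∷ []
graphs-distinct (suc n) = AllPairs-cartesianProductWith addVertex
  (λ (j , ne) → Fin.zero , Fin.suc j , z<s , ne)
  (λ (i , j , i<j , ne) → Fin.suc i , Fin.suc j , s<s i<j , ne)
  (boolVectors-distinct n) (graphs-distinct n)

-- A largest fibre

maximal : ∀ {m} .{{_ : NonZero m}} (f : Fin m → ℕ) → ∃[ κ ] (∀ κ′ → f κ′ ≤ f κ)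
maximal {suc zero} f = Fin.zero , λ { Fin.zero → ≤-refl }
maximal {suc (suc m)} f with maximal (f ∘ Fin.suc)
... | κ , max with ≤-total (f Fin.zero) (f (Fin.suc κ))
...   | inj₁ le = Fin.suc κ , λ { Fin.zero → le ; (Fin.suc κ′) → max κ′ }
...   | inj₂ ge = Fin.zero  , λ { Fin.zero → ≤-refl ; (Fin.suc κ′) → ≤-trans (max κ′) ge }

module _ {m} (φ : A → Fin m) where

  fibre : Fin m → List A → List A
  fibre κ = filter (λ x → φ x Fin.≟ κ)

  fibre-sizes : ∀ xs → length xs ≤ +-Sum.sum (λ κ → length (fibre κ xs))
  fibre-sizes []       = z≤n
  fibre-sizes (x ∷ xs) = begin
    suc (length xs)
      ≤⟨ s≤s (fibre-sizes xs) ⟩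
    1 + +-Sum.sum (λ κ → length (fibre κ xs))
      ≡⟨ cong (_+ +-Sum.sum (λ κ → length (fibre κ xs)))
           (trans (sum-single +-0-commutativeMonoid hit (φ x) miss) hit-φ) ⟨
    +-Sum.sum hit + +-Sum.sum (λ κ → length (fibre κ xs))
      ≡⟨ +-Sum.∑-distrib-+ hit (λ κ → length (fibre κ xs)) ⟨
    +-Sum.sum (λ κ → hit κ + length (fibre κ xs))
      ≡⟨ +-Sum.sum-cong-≗ add ⟩
    +-Sum.sum (λ κ → length (fibre κ (x ∷ xs))) ∎
    where
    open ≤-Reasoning
    hit : Fin m → ℕ
    hit κ = if does (φ x Fin.≟ κ) then 1 else 0
    hit-φ : hit (φ x) ≡ 1
    hit-φ with φ x Fin.≟ φ x
    ... | yes _ = refl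
    ... | no ne = contradiction refl ne
    miss : ∀ κ → κ ≢ φ x → hit κ ≡ 0
    miss κ κ≢ with φ x Fin.≟ κ
    ... | yes e = contradiction (sym e) κ≢
    ... | no _  = refl
    add : ∀ κ → hit κ + length (fibre κ xs) ≡ length (fibre κ (x ∷ xs))
    add κ with does (φ x Fin.≟ κ)
    ... | true  = refl
    ... | false = refl

  pigeonhole : .{{_ : NonZero m}} → ∀ xs → ∃[ κ ] length xs ≤ m * length (fibre κ xs)
  pigeonhole xs = let κ , max = maximal (λ κ → length (fibre κ xs)) in
    κ , ≤-trans (fibre-sizes xs) (sum≤ _ max)

  fibre-constant : ∀ κ {xs} {R : A → A → Set} → AllPairs R xs →
                   AllPairs (λ x y → R x y × φ x ≡ φ y) (fibre κ xs)
  fibre-constant κ {xs} xs! = AllPairs.zip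
    (AllPairs.filter⁺ _ xs! , constant (All.all-filter (λ x → φ x Fin.≟ κ) xs))
    where
    constant : ∀ {ys} → All (λ y → φ y ≡ κ) ys → AllPairs (λ x y → φ x ≡ φ y) ys
    constant []       = []
    constant (e ∷ es) = All.map (λ e′ → trans e (sym e′)) es ∷ constant es

-- The code is a largest class of graphs with a common syndrome, among `suc (m ^ 10) ^ 10` possible
-- syndromes.
K5-code-from-colouring : ∀ {n m} .{{_ : NonZero m}} (c : Fin n → Fin n → Fin m) →
  (∀ {vs} → length vs ≡ 5 → Unique vs → ¬ (∀ κ → pairs (λ i j → does (c i j Fin.≟ κ)) vs ≡ false)) →
  Σ (List (Graph n)) λ F → K5Code n F × (2 ^ (n C 2) ≤ suc (m ^ 10) ^ 10 * length F)
K5-code-from-colouring {n} {m} c odd-class =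
  let κ , large = pigeonhole φ {{m^n≢0 (suc (m ^ 10)) 10}} (graphs n) in
  fibre φ κ (graphs n) ,
  AllPairs.map (λ {G} {G′} (differ , eq) → differ , syndrome-K5 c odd-class G G′ eq)
    (fibre-constant φ κ (graphs-distinct n)) ,
  ≤-trans (≤-reflexive (sym (length-graphs n))) large
  where
  φ : Graph n → Fin (suc (m ^ 10) ^ 10)
  φ G = syndrome 10 (parity c G)

-- Least significant digit first, with `true` standing for the digit 0.
digit : ℕ → Bits
digit v zero    = does (v % 2 ≟ 0)
digit v (suc i) = digit (v / 2) i

digit-injective : ∀ L {v w} → v < 2 ^ L → w < 2 ^ L → (∀ i → i < L → digit v i ≡ digit w i) → v ≡ w
digit-injective zero    v< w< eq = trans (n<1⇒n≡0 v<) (sym (n<1⇒n≡0 w<))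
digit-injective (suc L) {v} {w} v< w< eq = begin
  v                 ≡⟨ m≡m%n+[m/n]*n v 2 ⟩
  v % 2 + v / 2 * 2 ≡⟨ cong₂ (λ r q → r + q * 2) (same-parity (eq 0 z<s) (m%n<n v 2) (m%n<n w 2))
                        (digit-injective L (half v<) (half w<) (λ i i<L → eq (suc i) (s≤s i<L))) ⟩
  w % 2 + w / 2 * 2 ≡⟨ m≡m%n+[m/n]*n w 2 ⟨
  w ∎
  where
  open ≡-Reasoning
  half : ∀ {u} → u < 2 ^ suc L → u / 2 < 2 ^ L
  half u< = m<n*o⇒m/o<n (<-≤-trans u< (≤-reflexive (*-comm 2 (2 ^ L))))
  same-parity : ∀ {p q} → does (p ≟ 0) ≡ does (q ≟ 0) → p < 2 → q < 2 → p ≡ q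
  same-parity {0} {0} _ _ _ = refl
  same-parity {1} {1} _ _ _ = refl
  same-parity {suc (suc _)} _ (s≤s (s≤s ())) _
  same-parity {_} {suc (suc _)} _ _ (s≤s (s≤s ()))

module _ (s : ℕ) .{{_ : NonZero s}} (t : ℕ) {n} (n≤ : n ≤ 2 ^ (t * s)) where
  open Colouring s t

  digits : Fin n → Bits
  digits i = digit (toℕ i)

  digits-distinct : ∀ {i j} → i ≢ j → δ (digits i) (digits j) < L
  digits-distinct {i} {j} i≢j = ≤∧≢⇒< (lcp≤ L _ _) λ e → i≢j (Fin.toℕ-injective
    (digit-injective L (bound i) (bound j) (λ k k<L → lcp-agree L (<-≤-trans k<L (≤-reflexive (sym e))))))
    where
    bound : ∀ i → toℕ i < 2 ^ L
    bound i = <-≤-trans (Fin.toℕ<n i) n≤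

  colouring-odd : ∀ {vs} → length vs ≡ 5 → Unique vs →
                  ¬ (∀ κ → pairs (λ i j → does (colour (digits i) (digits j) Fin.≟ κ)) vs ≡ false)
  colouring-odd {vs} len unique even = no-even-5 (trans (length-map digits vs) len)
    (AllPairs.map⁺ (AllPairs.map digits-distinct unique))
    (even-classes⇒even colour (map digits vs) λ κ →
      trans (pairs-map (λ u v → does (colour u v Fin.≟ κ)) digits vs) (even κ))

  instance
    colourCount-nonZero : NonZero (colourCount s t)
    colourCount-nonZero = m*n≢0 (suc L) _ {{_}} {{m*n≢0 (2 ^ s) _ {{m^n≢0 2 s}} {{m^n≢0 (suc s * 2) t}}}}

  K5-code : Σ (List (Graph n)) λ F →
            K5Code n F × (2 ^ (n C 2) ≤ suc (colourCount s t ^ 10) ^ 10 * length F)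
  K5-code = K5-code-from-colouring (λ i j → colour (digits i) (digits j)) colouring-odd

-- Counting colours

suc≤2^ : ∀ n → suc n ≤ 2 ^ n
suc≤2^ zero    = ≤-refl
suc≤2^ (suc n) = begin
  1 + suc n     ≤⟨ +-mono-≤ (m^n>0 2 n) (suc≤2^ n) ⟩
  2 ^ n + 2 ^ n ≡⟨ cong (λ x → 2 ^ n + x) (+-identityʳ (2 ^ n)) ⟨
  2 ^ suc n ∎
  where open ≤-Reasoning

^-distribʳ-* : ∀ a b r → (a * b) ^ r ≡ a ^ r * b ^ r
^-distribʳ-* a b zero    = refl
^-distribʳ-* a b (suc r) =
  trans (cong (a * b *_) (^-distribʳ-* a b r)) ([m*n]*[o*p]≡[m*o]*[n*p] a b (a ^ r) (b ^ r))

-- With `w = u / suc r`, each of the `r` factors `suc u` is at most `suc r * suc w`, and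
-- `suc w ≤ 2 ^ w`. The threshold makes `w` at least the collected constant `D`, which one more
-- factor `2 ^ w` absorbs; `suc r` factors `2 ^ w` fit into `2 ^ u`.
polynomial≤exponential : ∀ c r → ∃[ S ] (∀ u → S ≤ u → c * suc u ^ r ≤ 2 ^ u)
polynomial≤exponential c r = D * suc r , λ u S≤u →
  let open ≤-Reasoning
      w = u / suc r
      D≤w : D ≤ w
      D≤w = ≤-trans (≤-reflexive (sym (m*n/n≡m D (suc r)))) (/-monoˡ-≤ (suc r) S≤u)
      u< : suc u ≤ suc r * suc w
      u< = begin
        suc u                              ≡⟨ cong suc (m≡m%n+[m/n]*n u (suc r)) ⟩
        suc (u % suc r) + w * suc r        ≤⟨ +-monoˡ-≤ (w * suc r) (m%n<n u (suc r)) ⟩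
        suc w * suc r                      ≡⟨ *-comm (suc w) (suc r) ⟩
        suc r * suc w ∎
  in begin
    c * suc u ^ r                        ≤⟨ *-monoʳ-≤ c (^-monoˡ-≤ r u<) ⟩
    c * (suc r * suc w) ^ r              ≡⟨ cong (c *_) (^-distribʳ-* (suc r) (suc w) r) ⟩
    c * (suc r ^ r * suc w ^ r)          ≡⟨ *-assoc c (suc r ^ r) (suc w ^ r) ⟨
    D * suc w ^ r                        ≤⟨ *-mono-≤ (≤-trans D≤w (≤-trans (n≤1+n w) (suc≤2^ w)))
                                                     (^-monoˡ-≤ r (suc≤2^ w)) ⟩
    2 ^ w * (2 ^ w) ^ r                  ≡⟨ ^-*-assoc 2 w (suc r) ⟩
    2 ^ (w * suc r)                      ≤⟨ ^-monoʳ-≤ 2 (m/n*n≤m u (suc r)) ⟩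
    2 ^ u ∎
  where
  D : ℕ
  D = c * suc r ^ r

power-window : ∀ b → 1 < b → ∀ n → 1 ≤ n → ∃[ u ] (b ^ u ≤ n × n < b ^ suc u)
power-window b 1<b (suc zero) _ = 0 , ≤-refl , ≤-trans 1<b (≤-reflexive (sym (*-identityʳ b)))
power-window b 1<b (suc n@(suc _)) _ with power-window b 1<b n z<s
... | u , lower , upper with m≤n⇒m<n∨m≡n upper
...   | inj₁ lt = u , m≤n⇒m≤1+n lower , lt
...   | inj₂ eq = suc u , ≤-reflexive (sym eq) ,
                  ≤-trans (s≤s (≤-reflexive eq)) (^-monoʳ-< b 1<b (n<1+n (suc u)))

-- For fixed `t` only the count of prefixes, `2 ^ suc u`, is exponential in `u`. The remaining
-- factors are bounded by a constant times `suc u ^ suc t`, which a second `2 ^ u` absorbs.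
colourCount≤ : ∀ t → ∃[ S ] (∀ u → S ≤ u → colourCount (suc u) t ≤ 2 ^ (2 * u))
colourCount≤ t = let S , small = polynomial≤exponential c (suc t) in S , λ u S≤u → begin
  suc (t * suc u) * (2 ^ suc u * (suc (suc u) * 2) ^ t)
    ≤⟨ *-mono-≤ (+-monoˡ-≤ (t * suc u) (s≤s (z≤n {u}))) (*-monoʳ-≤ (2 ^ suc u) (^-monoˡ-≤ t (double u))) ⟩
  suc t * suc u * (2 ^ suc u * (4 * suc u) ^ t)
    ≡⟨ cong (λ z → suc t * suc u * (2 ^ suc u * z)) (^-distribʳ-* 4 (suc u) t) ⟩
  suc t * suc u * (2 * 2 ^ u * (4 ^ t * suc u ^ t))
    ≡⟨ rearrange (suc t) (suc u) (2 ^ u) (4 ^ t) (suc u ^ t) ⟩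
  c * suc u ^ suc t * 2 ^ u
    ≤⟨ *-monoˡ-≤ (2 ^ u) (small u S≤u) ⟩
  2 ^ u * 2 ^ u
    ≡⟨ ^-distribˡ-+-* 2 u u ⟨
  2 ^ (u + u)
    ≡⟨ cong (λ v → 2 ^ (u + v)) (+-identityʳ u) ⟨
  2 ^ (2 * u) ∎
  where
  open ≤-Reasoning
  c : ℕ
  c = 2 * suc t * 4 ^ t
  double : ∀ u → suc (suc u) * 2 ≤ 4 * suc u
  double u = ≤-trans (m≤m+n (suc (suc u) * 2) (u * 2)) (≤-reflexive
    (solve 1 (λ u → (con 2 :+ u) :* con 2 :+ u :* con 2 := con 4 :* (con 1 :+ u)) refl u))
    where open ℕ.+-*-Solver
  rearrange : ∀ a b p q r → a * b * (2 * p * (q * r)) ≡ 2 * a * q * (b * r) * p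
  rearrange = solve 5 (λ a b p q r → a :* b :* (con 2 :* p :* (q :* r)) :=
                                     con 2 :* a :* q :* (b :* r) :* p) refl
    where open ℕ.+-*-Solver

2≤colourCount : ∀ u t → 2 ≤ colourCount (suc u) t
2≤colourCount u t = begin
  2                                       ≤⟨ m≤m*n 2 (2 ^ u) {{m^n≢0 2 u}} ⟩
  2 ^ suc u                               ≤⟨ m≤m*n (2 ^ suc u) X {{m^n≢0 (suc (suc u) * 2) t}} ⟩
  2 ^ suc u * X                           ≤⟨ m≤n*m (2 ^ suc u * X) (suc (t * suc u)) ⟩
  colourCount (suc u) t ∎
  where
  open ≤-Reasoning
  X : ℕ
  X = (suc (suc u) * 2) ^ t

-- Doubling `m ^ 10` costs at most one more factor `m`, and 110 is 11 times 10.
syndromeCount≤ : ∀ {m} → 2 ≤ m → suc (m ^ 10) ^ 10 ≤ m ^ 110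
syndromeCount≤ {m} 2≤m = begin
  suc (m ^ 10) ^ 10 ≤⟨ ^-monoˡ-≤ 10 (begin
     1 + m ^ 10     ≤⟨ +-monoˡ-≤ (m ^ 10) (m^n>0 m {{>-nonZero (<-trans z<s 2≤m)}} 10) ⟩
     m ^ 10 + m ^ 10 ≡⟨ cong (λ x → m ^ 10 + x) (+-identityʳ (m ^ 10)) ⟨
     2 * m ^ 10     ≤⟨ *-monoˡ-≤ (m ^ 10) 2≤m ⟩
     m ^ 11 ∎) ⟩
  (m ^ 11) ^ 10     ≡⟨ ^-*-assoc m 11 10 ⟩
  m ^ 110 ∎
  where open ≤-Reasoning

-- Taking `k`-th roots gives density at least n^(-1/k) for all `n` from some `N` on, where `N` may
-- depend on `k`. As `k` is arbitrary, the exponent tends to 0; this form avoids real powers.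
theorem2 : (k : ℕ) → 1 ≤ k →
    ∃[ N ] ((n : ℕ) → N ≤ n →
    Σ (List (Graph n)) λ F → K5Code n F × (2 ^ (k * (n C 2)) ≤ length F ^ k * n))
theorem2 k 1≤k = let S , small = colourCount≤ t in b ^ S , λ n N≤n →
  -- The lower bound on `n` pays for the syndromes; the upper bound says that `t` blocks of length
  -- `suc u` suffice to write every vertex in binary.
  let u , lower , upper = power-window b 1<b n (≤-trans (m^n>0 b S) N≤n)
      -- If `u` were below `S`, then `n < b ^ suc u ≤ b ^ S ≤ n`.
      S≤u = ≮⇒≥ λ u<S → <-irrefl refl (<-≤-trans upper (≤-trans (^-monoʳ-≤ b u<S) N≤n))
      F , code , large = K5-code (suc u) t (≤-trans (<⇒≤ upper) (≤-reflexive (^-*-assoc 2 t (suc u))))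
  in F , code , density n u (length F) (small u S≤u) lower large
  where
  -- With t blocks of length u + 1 there are m ≤ 2 ^ (2 * u) colours, hence at most m ^ 110 values of
  -- the syndrome, and t is such that (m ^ 110) ^ k ≤ 2 ^ (t * u) ≤ n.
  t b : ℕ
  t = 2 * (110 * k)
  b = 2 ^ t

  instance
    b-nonZero : NonZero b
    b-nonZero = m^n≢0 2 t

  1<b : 1 < b
  1<b = ^-monoʳ-< 2 (s≤s (s≤s z≤n)) {0} (*-mono-≤ {1} {2} (s≤s z≤n) (*-mono-≤ {1} {110} (s≤s z≤n) 1≤k))

  density : ∀ n u f → colourCount (suc u) t ≤ 2 ^ (2 * u) → b ^ u ≤ n →
            2 ^ (n C 2) ≤ suc (colourCount (suc u) t ^ 10) ^ 10 * f → 2 ^ (k * (n C 2)) ≤ f ^ k * n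
  density n u f small lower large = begin
    2 ^ (k * (n C 2))                  ≡⟨ cong (2 ^_) (*-comm k (n C 2)) ⟩
    2 ^ ((n C 2) * k)                  ≡⟨ ^-*-assoc 2 (n C 2) k ⟨
    (2 ^ (n C 2)) ^ k                  ≤⟨ ^-monoˡ-≤ k large ⟩
    (suc (m ^ 10) ^ 10 * f) ^ k        ≡⟨ ^-distribʳ-* (suc (m ^ 10) ^ 10) f k ⟩
    (suc (m ^ 10) ^ 10) ^ k * f ^ k    ≤⟨ *-monoˡ-≤ (f ^ k)
                                            (^-monoˡ-≤ k (syndromeCount≤ (2≤colourCount u t))) ⟩
    (m ^ 110) ^ k * f ^ k              ≡⟨ cong (_* f ^ k) (^-*-assoc m 110 k) ⟩
    m ^ (110 * k) * f ^ k              ≤⟨ *-monoˡ-≤ (f ^ k) (^-monoˡ-≤ (110 * k) small) ⟩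
    (2 ^ (2 * u)) ^ (110 * k) * f ^ k  ≡⟨ cong (_* f ^ k) (^-*-assoc 2 (2 * u) (110 * k)) ⟩
    2 ^ (2 * u * (110 * k)) * f ^ k    ≡⟨ cong (λ e → 2 ^ e * f ^ k) (exponent (110 * k)) ⟩
    2 ^ (t * u) * f ^ k                ≡⟨ cong (_* f ^ k) (^-*-assoc 2 t u) ⟨
    b ^ u * f ^ k                      ≤⟨ *-monoˡ-≤ (f ^ k) lower ⟩
    n * f ^ k                          ≡⟨ *-comm n (f ^ k) ⟩
    f ^ k * n ∎
    where
    open ≤-Reasoning
    m : ℕ
    m = colourCount (suc u) t
    exponent : ∀ K → 2 * u * K ≡ 2 * K * u
    exponent K = trans (*-assoc 2 u K) (trans (cong (2 *_) (*-comm u K)) (sym (*-assoc 2 K u)))
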